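{- Let $P$ be a simple polytope given by a minimal representation. All circuit walks in $P$ are edge walks if and only if $I^{uv}(u)=-I^{uv}(v)$ for all pairs of vertices $u,v$ of $P$.
   Context: A polytope $P=\{x: Ax=b,\ Bx\le d\}$ ($A,B$ rational) is given by a minimal representation if every inequality of $Bx\le d$ defines a facet of $P$. $P$ is simple if each vertex lies in exactly $\dim P$ facets. Circuits: $\mathcal C(A,B)$ is the set of $g\in\ker(A)\setminus\{0\}$ with coprime integer components such that the support of $Bg$ is inclusion-minimal among supports of $Bx$, $x\in\ker(A)\setminus\{0\}$. For vertices $v^{(1)},v^{(2)}$, a circuit walk is a sequence $v^{(1)}=y^{(0)},\dots,y^{(k)}=v^{(2)}$ with $y^{(i)}\in P$, $y^{(i+1)}=y^{(i)}+\alpha_i g^{(i)}$ for some $g^{(i)}\in\mathcal C(A,B)$ and $\alpha_i>0$, and $y^{(i)}+\alpha g^{(i)}\notin P$ for all $\alpha>\alpha_i$; it is an edge walk if every $y^{(i)}$ is a vertex and each segment $[y^{(i)},y^{(i+1)}]$ is an edge of $P$. For vertices $u,v$, $P^{uv}$ denotes the inclusion-minimal face of $P$ containing $u$ and $v$, and $I^{uv}(u)=\{g: u+\varepsilon g\in P^{uv}\text{ for some }\varepsilon>0\}$ is the inner cone of $u$ with respect to $P^{uv}$ (similarly $I^{uv}(v)$).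
   Formalization: The polytope is taken in rational rather than real n-space: the right-hand sides b and d, the points of P, the step lengths of the walks and the directions in the inner cones are all rational. -}

module Defs where

open import Data.Nat using (ℕ; zero; suc)
open import Data.Nat.Divisibility using (_∣_)
open import Data.Integer as ℤ using (ℤ; ∣_∣)
open import Data.Rational using (ℚ; 0ℚ; 1ℚ; _+_; _*_; -_; _-_; _≤_; _<_; _/_)
open import Data.Fin using (Fin; zero; suc; inject₁; fromℕ)
open import Data.Product using (Σ; ∃; _×_; _,_)
open import Relation.Binary.PropositionalEquality using (_≡_)
open import Relation.Nullary using (¬_)
open import Function.Bundles using (_⇔_)

Vecℚ : ℕ → Set
Vecℚ n = Fin n → ℚ

infixl 6 _⊕_ _⊖_
infixl 7 _·_
infix 4 _≈_ _⊆_ _≐_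

sumℚ : ∀ {n} → (Fin n → ℚ) → ℚ
sumℚ {zero}  f = 0ℚ
sumℚ {suc n} f = f zero + sumℚ (λ i → f (suc i))

dot : ∀ {n} → Vecℚ n → Vecℚ n → ℚ
dot x y = sumℚ (λ i → x i * y i)

_⊕_ : ∀ {n} → Vecℚ n → Vecℚ n → Vecℚ n
(x ⊕ y) i = x i + y i

_⊖_ : ∀ {n} → Vecℚ n → Vecℚ n → Vecℚ n
(x ⊖ y) i = x i - y i

_·_ : ∀ {n} → ℚ → Vecℚ n → Vecℚ n
(t · x) i = t * x i

neg : ∀ {n} → Vecℚ n → Vecℚ n
neg x i = - x i

zeroV : ∀ {n} → Vecℚ n
zeroV i = 0ℚ

_≈_ : ∀ {n} → Vecℚ n → Vecℚ n → Set
x ≈ y = ∀ i → x i ≡ y i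

NonZeroV : ∀ {n} → Vecℚ n → Set
NonZeroV {n} x = Σ (Fin n) λ i → ¬ (x i ≡ 0ℚ)

toℚ : ∀ {n} → (Fin n → ℤ) → Vecℚ n
toℚ g i = g i / 1

Pred : ℕ → Set₁
Pred n = Vecℚ n → Set

_⊆_ : ∀ {n} → Pred n → Pred n → Set
S ⊆ T = ∀ x → S x → T x

_≐_ : ∀ {n} → Pred n → Pred n → Set
S ≐ T = (S ⊆ T) × (T ⊆ S)

AffIndep : ∀ {n k} → Vecℚ n → (Fin k → Vecℚ n) → Set
AffIndep {n} {k} p₀ p =
  (λ' : Fin k → ℚ) →
  (∀ j → sumℚ (λ i → λ' i * (p i ⊖ p₀) j) ≡ 0ℚ) →
  ∀ i → λ' i ≡ 0ℚ

HasAffIndep : ∀ {n} → Pred n → ℕ → Set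
HasAffIndep S zero    = ⊤'
  where open import Data.Unit using () renaming (⊤ to ⊤')
HasAffIndep {n} S (suc k) =
  Σ (Vecℚ n) λ p₀ → Σ (Fin k → Vecℚ n) λ p →
    S p₀ × (∀ i → S (p i)) × AffIndep p₀ p

-- Affine rank: r = dim S + 1 (so the empty set has rank 0, i.e. dim −1).
Rank : ∀ {n} → Pred n → ℕ → Set
Rank S r = HasAffIndep S r × ¬ HasAffIndep S (suc r)

module Poly {n p m : ℕ}
  (A : Fin p → Vecℚ n) (b : Fin p → ℚ)
  (B : Fin m → Vecℚ n) (d : Fin m → ℚ) where

  InP : Pred n
  InP x = (∀ i → dot (A i) x ≡ b i) × (∀ j → dot (B j) x ≤ d j)

  Bounded : Set
  Bounded = Σ ℚ λ M → ∀ x → InP x → ∀ i → (- M ≤ x i) × (x i ≤ M)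

  Valid : Vecℚ n → ℚ → Set
  Valid c δ = ∀ x → InP x → dot c x ≤ δ

  FaceSet : Vecℚ n → ℚ → Pred n
  FaceSet c δ x = InP x × dot c x ≡ δ

  IsFace : Pred n → Set
  IsFace F = Σ (Vecℚ n) λ c → Σ ℚ λ δ → Valid c δ × (F ≐ FaceSet c δ)

  IsFacet : Pred n → Set
  IsFacet F = IsFace F × (∀ r → Rank InP (suc r) → Rank F r)

  IsVertex : Vecℚ n → Set
  IsVertex v = IsFace (λ x → x ≈ v)

  IneqFace : Fin m → Pred n
  IneqFace j x = InP x × dot (B j) x ≡ d j

  MinimalRep : Set
  MinimalRep = ∀ j → IsFacet (IneqFace j)

  -- simple: every vertex lies in exactly dim P facets
  -- (facets counted as distinct subsets of ℚⁿ)
  Simple : Set₁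
  Simple = ∀ v → IsVertex v → ∀ k → Rank InP (suc k) →
    Σ (Fin k → Pred n) λ F →
      (∀ i → IsFacet (F i) × F i v) ×
      (∀ i j → F i ≐ F j → i ≡ j) ×
      (∀ G → IsFacet G → G v → Σ (Fin k) λ i → G ≐ F i)

  Supp : Vecℚ n → Fin m → Set
  Supp x j = ¬ (dot (B j) x ≡ 0ℚ)

  InKer : Vecℚ n → Set
  InKer x = ∀ i → dot (A i) x ≡ 0ℚ

  Coprime : (Fin n → ℤ) → Set
  Coprime g = ∀ k → (∀ i → k ∣ (∣ g i ∣)) → k ≡ 1

  IsCircuit : (Fin n → ℤ) → Set
  IsCircuit g =
    InKer (toℚ g) × NonZeroV (toℚ g) × Coprime g ×
    (∀ x → InKer x → NonZeroV x →
       (∀ j → Supp x j → Supp (toℚ g) j) →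
       ∀ j → Supp (toℚ g) j → Supp x j)

  IsCircuitWalk : Vecℚ n → Vecℚ n → (k : ℕ) → (Fin (suc k) → Vecℚ n) → Set
  IsCircuitWalk v₁ v₂ k y =
    (y zero ≈ v₁) × (y (fromℕ k) ≈ v₂) × (∀ i → InP (y i)) ×
    (∀ (i : Fin k) → Σ (Fin n → ℤ) λ g → Σ ℚ λ α →
       IsCircuit g × (0ℚ < α) ×
       (y (suc i) ≈ y (inject₁ i) ⊕ (α · toℚ g)) ×
       (∀ α' → α < α' → ¬ InP (y (inject₁ i) ⊕ (α' · toℚ g))))

  Segment : Vecℚ n → Vecℚ n → Pred n
  Segment a c x = Σ ℚ λ t → (0ℚ ≤ t) × (t ≤ 1ℚ) × (x ≈ a ⊕ (t · (c ⊖ a)))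

  IsEdge : Vecℚ n → Vecℚ n → Set
  IsEdge a c = IsFace (Segment a c) × Rank (Segment a c) 2

  IsEdgeWalk : (k : ℕ) → (Fin (suc k) → Vecℚ n) → Set
  IsEdgeWalk k y =
    (∀ i → IsVertex (y i)) × (∀ (i : Fin k) → IsEdge (y (inject₁ i)) (y (suc i)))

  AllCircuitWalksAreEdgeWalks : Set
  AllCircuitWalksAreEdgeWalks =
    ∀ v₁ v₂ → IsVertex v₁ → IsVertex v₂ → ∀ k y →
    IsCircuitWalk v₁ v₂ k y → IsEdgeWalk k y

  IsMinFace : Pred n → Vecℚ n → Vecℚ n → Set₁
  IsMinFace F u v = IsFace F × F u × F v ×
    (∀ G → IsFace G → G u → G v → F ⊆ G)

  InnerCone : Pred n → Vecℚ n → Pred n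
  InnerCone F w g = Σ ℚ λ ε → (0ℚ < ε) × F (w ⊕ (ε · g))

  InnerConeCondition : Set₁
  InnerConeCondition =
    ∀ u v → IsVertex u → IsVertex v → ∀ F → IsMinFace F u v →
    ∀ g → InnerCone F u g ⇔ InnerCone F v (neg g)

{-# OPTIONS --safe #-}

-- At a vertex u of a simple polytope every facet i through u is left by exactly one edge direction eᵢ, and the
-- feasible directions at u form the simplicial cone spanned by the eᵢ.
--
-- From cones to walks: let j be a row that is not active at u.  The facet of j has a vertex v off facet i, so eᵢ
-- lies in the inner cone of u towards v, and the cone condition gives Bⱼ eᵢ ≥ 0.  Hence in g = Σ cᵢ eᵢ with
-- cᵢ ≥ 0 the terms Bⱼ (cᵢ eᵢ) have the same sign for each row j, the support of B eᵢ lies in that of B g whenever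
-- cᵢ > 0, and a circuit g that is feasible at u must be one of the edge directions.
--
-- From walks to cones: a circuit that is feasible at u is the first step of some circuit walk ending in a vertex,
-- hence an edge direction.  Given vertices u, v with v off facet i and on facet j, an element of least support
-- among the directions x with Bᵢ x < 0, Bⱼ x ≥ 0 that are feasible at u (such as v − u) is a circuit, hence
-- parallel to eᵢ; so Bⱼ eᵢ ≥ 0, which makes −eᵢ feasible at v.
--
-- The witnesses involved exist only up to double negation.  This suffices, because all conclusions come down to
-- equations and inequalities between rationals, which are decidable.

module Submission where

open import Defs
open import Data.Nat as ℕ using (ℕ; zero; suc)
import Data.Nat.Properties as ℕP
open import Data.Nat.Divisibility using (_∣_)
open import Data.Integer as ℤ using (ℤ) renaming (+_ to int)
import Data.Integer.Properties as ℤP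
open import Data.Integer.Divisibility.Signed using (∣ᵤ⇒∣) renaming (_∣_ to _∣ˢ_)
open import Data.Fin using (Fin; zero; suc; punchIn; punchOut)
import Data.Fin.Properties as FinP
open import Data.Rational
  using (ℚ; mkℚ; 0ℚ; 1ℚ; ½; ↥_; ↧_; toℚᵘ; _/_; _+_; _*_; -_; _-_; _≤_; _<_; 1/_; positive; nonNegative; ≢-nonZero)
open import Data.Rational.Properties as ℚP
  using (+-*-commutativeRing; _≟_; _≤?_; _<?_; <-cmp; ≤-refl; ≤-trans; ≤-antisym; ≤-reflexive;
         <⇒≤; <-irrefl; <⇒≢; ≮⇒≥; ≰⇒>; <-≤-trans; ≤-<-trans)
open import Data.Rational.Unnormalised as ℚᵘ using (mkℚᵘ)
import Data.Rational.Unnormalised.Properties as ℚᵘP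
open import Data.Product using (Σ; _×_; _,_; proj₁; proj₂)
open import Data.Sum using (_⊎_; inj₁; inj₂; [_,_]′)
open import Data.Empty using (⊥)
open import Function.Base using (_∘_)
open import Function.Bundles using (_⇔_; mk⇔; Equivalence)
open import Level using (0ℓ)
open import Relation.Binary using (tri<; tri≈; tri>)
open import Relation.Binary.PropositionalEquality
  using (_≡_; _≢_; refl; sym; trans; cong; cong₂; subst; subst₂)
open import Relation.Nullary using (¬_; Dec; yes; no; contradiction; ¬?)
open import Relation.Nullary.Decidable
  using (dec⇒maybe; decidable-stable; ¬¬-excluded-middle; _×-dec_)
open import Tactic.RingSolver using (solve-∀)
open import Tactic.RingSolver.Core.AlmostCommutativeRing
  using (AlmostCommutativeRing; fromCommutativeRing)

-- The definitions speak of supporting hyperplanes and affine rank, the argument of rows and signs.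
-- Faces are turned into rows by one observation: a direction of ker A on which all active rows
-- vanish can be followed a little both ways, so a functional that is maximal over P at the point
-- vanishes on it. Rank is turned into rows by a point of P at which every row is strict. It exists
-- because a minimal representation has no row that is tight on all of P, and every direction of ker
-- A is feasible there, so the rank bounds the independent families in ker A. Boundedness makes
-- maximal steps end and makes B injective on ker A; otherwise a nonzero direction could have empty
-- support. Inductions run on the number of inactive, leaving or supporting rows, which is
-- computable. Whether a direction with prescribed signs exists is instead settled by excluded
-- middle under a double negation.

private
  ℚ-ring : AlmostCommutativeRing 0ℓ 0ℓ
  ℚ-ring = fromCommutativeRing +-*-commutativeRing (λ x → dec⇒maybe (0ℚ ≟ x))


-- Classical reasoning inside the double-negation monad

infixl 1 _>>=_

_>>=_ : ∀ {a b} {A : Set a} {B : Set b} → ¬ ¬ A → (A → ¬ ¬ B) → ¬ ¬ B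
(m >>= f) k = m (λ a → f a k)

return : ∀ {a} {A : Set a} → A → ¬ ¬ A
return a k = k a

-- Finiteness of the index set is what lets the double negation move past the quantifier.
¬¬-choice : ∀ {a k} {X : Fin k → Set a} → (∀ i → ¬ ¬ X i) → ¬ ¬ (∀ i → X i)
¬¬-choice {k = zero}  f = return λ ()
¬¬-choice {k = suc k} f = do
  x ← f zero
  g ← ¬¬-choice (f ∘ suc)
  return λ { zero → x ; (suc i) → g i }

≡-stable : ∀ {x y : ℚ} → ¬ ¬ (x ≡ y) → x ≡ y
≡-stable = decidable-stable (_ ≟ _)

≤-stable : ∀ {x y : ℚ} → ¬ ¬ (x ≤ y) → x ≤ y
≤-stable = decidable-stable (_ ≤? _)

-- Ordered field arithmetic

p≤q⇒0≤q-p : ∀ {p q} → p ≤ q → 0ℚ ≤ q - p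
p≤q⇒0≤q-p {p} {q} p≤q = subst (_≤ q - p) (ℚP.+-inverseʳ p) (ℚP.+-monoˡ-≤ (- p) p≤q)

p<q⇒0<q-p : ∀ {p q} → p < q → 0ℚ < q - p
p<q⇒0<q-p {p} {q} p<q = subst (_< q - p) (ℚP.+-inverseʳ p) (ℚP.+-monoˡ-< (- p) p<q)

private
  add-diff : ∀ p q → q - p + p ≡ q
  add-diff = solve-∀ ℚ-ring

0≤q-p⇒p≤q : ∀ {p q} → 0ℚ ≤ q - p → p ≤ q
0≤q-p⇒p≤q {p} {q} h = subst₂ _≤_ (ℚP.+-identityˡ p) (add-diff p q) (ℚP.+-monoˡ-≤ p h)

0<q-p⇒p<q : ∀ {p q} → 0ℚ < q - p → p < q
0<q-p⇒p<q {p} {q} h = subst₂ _<_ (ℚP.+-identityˡ p) (add-diff p q) (ℚP.+-monoˡ-< p h)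

≤-by : ∀ {p q} r → 0ℚ ≤ r → q - p ≡ r → p ≤ q
≤-by r h eq = 0≤q-p⇒p≤q (subst (0ℚ ≤_) (sym eq) h)

<-by : ∀ {p q} r → 0ℚ < r → q - p ≡ r → p < q
<-by r h eq = 0<q-p⇒p<q (subst (0ℚ <_) (sym eq) h)

+-nonneg : ∀ {p q} → 0ℚ ≤ p → 0ℚ ≤ q → 0ℚ ≤ p + q
+-nonneg = ℚP.+-mono-≤

+-pos : ∀ {p q} → 0ℚ < p → 0ℚ ≤ q → 0ℚ < p + q
+-pos = ℚP.+-mono-<-≤

*-nonneg : ∀ {p q} → 0ℚ ≤ p → 0ℚ ≤ q → 0ℚ ≤ p * q
*-nonneg {p} {q} 0≤p 0≤q =
  subst (_≤ p * q) (ℚP.*-zeroʳ p) (ℚP.*-monoˡ-≤-nonNeg p {{nonNegative 0≤p}} 0≤q)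

*-pos : ∀ {p q} → 0ℚ < p → 0ℚ < q → 0ℚ < p * q
*-pos {p} {q} 0<p 0<q =
  subst (_< p * q) (ℚP.*-zeroʳ p) (ℚP.*-monoʳ-<-pos p {{positive 0<p}} 0<q)

p≤0⇒0≤-p : ∀ {p} → p ≤ 0ℚ → 0ℚ ≤ - p
p≤0⇒0≤-p = ℚP.neg-antimono-≤

0≤p⇒-p≤0 : ∀ {p} → 0ℚ ≤ p → - p ≤ 0ℚ
0≤p⇒-p≤0 = ℚP.neg-antimono-≤

p<0⇒0<-p : ∀ {p} → p < 0ℚ → 0ℚ < - p
p<0⇒0<-p = ℚP.neg-antimono-<

0≤-p⇒p≤0 : ∀ {p} → 0ℚ ≤ - p → p ≤ 0ℚ
0≤-p⇒p≤0 {p} h = ≤-by (- p) h (ℚP.+-identityˡ (- p))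

-p≤0⇒0≤p : ∀ {p} → - p ≤ 0ℚ → 0ℚ ≤ p
-p≤0⇒0≤p {p} h = subst (0ℚ ≤_) (neg-neg p) (p≤0⇒0≤-p h)
  where
  neg-neg : ∀ p → - (- p) ≡ p
  neg-neg = solve-∀ ℚ-ring

≤∧≢⇒< : ∀ {p q} → p ≤ q → p ≢ q → p < q
≤∧≢⇒< p≤q p≢q = ≰⇒> (p≢q ∘ ≤-antisym p≤q)

pos≢0 : ∀ {p} → 0ℚ < p → p ≢ 0ℚ
pos≢0 0<p p≡0 = <⇒≢ 0<p (sym p≡0)

0<1 : 0ℚ < 1ℚ
0<1 = ℚP.positive⁻¹ 1ℚ

0<½ : 0ℚ < ½
0<½ = ℚP.positive⁻¹ ½

pos-inverse : ∀ {p} → 0ℚ < p → Σ ℚ λ q → 0ℚ < q × p * q ≡ 1ℚ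
pos-inverse {p} 0<p =
  (1/ p) {{nz}} ,
  ℚP.positive⁻¹ ((1/ p) {{nz}}) {{ℚP.1/pos⇒pos p {{positive 0<p}}}} ,
  ℚP.*-inverseʳ p {{nz}}
  where nz = ℚP.pos⇒nonZero p {{positive 0<p}}

inverse : ∀ {p} → p ≢ 0ℚ → Σ ℚ λ q → p * q ≡ 1ℚ
inverse {p} p≢0 = (1/ p) {{≢-nonZero p≢0}} , ℚP.*-inverseʳ p {{≢-nonZero p≢0}}

*-cancel-0 : ∀ {p q} → p ≢ 0ℚ → p * q ≡ 0ℚ → q ≡ 0ℚ
*-cancel-0 {p} {q} p≢0 pq≡0 with inverse p≢0
... | r , pr≡1 = trans (sym (ℚP.*-identityˡ q))
  (trans (cong (_* q) (sym pr≡1)) (trans (shuffle p q r) (trans (cong (r *_) pq≡0) (ℚP.*-zeroʳ r))))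
  where
  shuffle : ∀ p q r → p * r * q ≡ r * (p * q)
  shuffle = solve-∀ ℚ-ring

*-cancel-nonneg : ∀ {p q} → 0ℚ < p → 0ℚ ≤ p * q → 0ℚ ≤ q
*-cancel-nonneg {p} {q} 0<p 0≤pq = ℚP.*-cancelˡ-≤-pos p {{positive 0<p}}
  (subst (_≤ p * q) (sym (ℚP.*-zeroʳ p)) 0≤pq)

*-square-pos : ∀ {p} → p ≢ 0ℚ → 0ℚ < p * p
*-square-pos {p} p≢0 with <-cmp p 0ℚ
... | tri< p<0 _ _ = subst (0ℚ <_) (neg² p) (*-pos (p<0⇒0<-p p<0) (p<0⇒0<-p p<0))
  where
  neg² : ∀ p → - p * - p ≡ p * p
  neg² = solve-∀ ℚ-ring
... | tri≈ _ p≡0 _ = contradiction p≡0 p≢0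
... | tri> _ _ 0<p = *-pos 0<p 0<p

*-square-nonneg : ∀ p → 0ℚ ≤ p * p
*-square-nonneg p with p ≟ 0ℚ
... | yes refl = ≤-refl
... | no p≢0   = <⇒≤ (*-square-pos p≢0)

≢0⇒>0⊎<0 : ∀ {p} → p ≢ 0ℚ → 0ℚ < p ⊎ p < 0ℚ
≢0⇒>0⊎<0 {p} p≢0 with <-cmp p 0ℚ
... | tri< p<0 _ _ = inj₂ p<0
... | tri≈ _ p≡0 _ = contradiction p≡0 p≢0
... | tri> _ _ p>0 = inj₁ p>0

-- Here `p` is the value of a row before a move and `q` its value after it: a nonnegative product
-- and preserved zeros mean that the row does not change sign.
keep≥ : ∀ p q → 0ℚ ≤ p * q → (p ≡ 0ℚ → q ≡ 0ℚ) → 0ℚ ≤ p → 0ℚ ≤ q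
keep≥ p q pq≥0 stays p≥0 with p ≟ 0ℚ
... | yes p≡0 = ≤-reflexive (sym (stays p≡0))
... | no p≢0  = *-cancel-nonneg (≤∧≢⇒< p≥0 (p≢0 ∘ sym)) pq≥0

keep≤ : ∀ p q → 0ℚ ≤ p * q → (p ≡ 0ℚ → q ≡ 0ℚ) → p ≤ 0ℚ → q ≤ 0ℚ
keep≤ p q pq≥0 stays p≤0 with p ≟ 0ℚ
... | yes p≡0 = ≤-reflexive (stays p≡0)
... | no p≢0  = 0≤-p⇒p≤0 (*-cancel-nonneg (p<0⇒0<-p (≤∧≢⇒< p≤0 p≢0)) (subst (0ℚ ≤_) (sym (neg² p q)) pq≥0))
  where
  neg² : ∀ a b → - a * - b ≡ a * b
  neg² = solve-∀ ℚ-ring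

-- The ratio test: the largest t with t a ≤ s

max-ratio : ∀ {m} (a s : Fin m → ℚ) → (∀ j → 0ℚ ≤ s j) →
  (∀ j → a j ≤ 0ℚ) ⊎
  Σ ℚ λ t → 0ℚ ≤ t × (∀ j → t * a j ≤ s j) × Σ (Fin m) λ j → 0ℚ < a j × t * a j ≡ s j
max-ratio {zero}  a s s≥0 = inj₁ λ ()
max-ratio {suc m} a s s≥0 with a zero ≤? 0ℚ | max-ratio (a ∘ suc) (s ∘ suc) (s≥0 ∘ suc)
... | yes a₀≤0 | inj₁ a≤0 = inj₁ λ { zero → a₀≤0 ; (suc j) → a≤0 j }
... | yes a₀≤0 | inj₂ (t , t≥0 , ta≤s , j , aⱼ>0 , eq) =
  inj₂ (t , t≥0 , (λ { zero → ta₀≤s₀ ; (suc j) → ta≤s j }) , suc j , aⱼ>0 , eq)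
  where
  eqn : ∀ t a s → s - t * a ≡ s + t * - a
  eqn = solve-∀ ℚ-ring
  ta₀≤s₀ : t * a zero ≤ s zero
  ta₀≤s₀ = ≤-by _ (+-nonneg (s≥0 zero) (*-nonneg t≥0 (p≤0⇒0≤-p a₀≤0))) (eqn t (a zero) (s zero))
... | no a₀≰0 | rest = combine rest
  where
  a₀>0 : 0ℚ < a zero
  a₀>0 = ≰⇒> a₀≰0
  r t₀ : ℚ
  r  = proj₁ (pos-inverse a₀>0)
  t₀ = s zero * r
  t₀≥0 : 0ℚ ≤ t₀
  t₀≥0 = *-nonneg (s≥0 zero) (<⇒≤ (proj₁ (proj₂ (pos-inverse a₀>0))))
  cancel : ∀ s r a → s * r * a ≡ s * (a * r)
  cancel = solve-∀ ℚ-ring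
  t₀a₀≡s₀ : t₀ * a zero ≡ s zero
  t₀a₀≡s₀ = trans (cancel (s zero) r (a zero))
    (trans (cong (s zero *_) (proj₂ (proj₂ (pos-inverse a₀>0)))) (ℚP.*-identityʳ (s zero)))
  eqn : ∀ t a s → s - t * a ≡ s + t * - a
  eqn = solve-∀ ℚ-ring
  eqn′ : ∀ t t₀ a s → s - t₀ * a ≡ (s - t * a) + (t - t₀) * a
  eqn′ = solve-∀ ℚ-ring
  small : ∀ {a s} → 0ℚ ≤ s → a ≤ 0ℚ → t₀ * a ≤ s
  small {a} {s} s≥0 a≤0 = ≤-by _ (+-nonneg s≥0 (*-nonneg t₀≥0 (p≤0⇒0≤-p a≤0))) (eqn t₀ a s)
  combine : _ → _
  combine (inj₁ a≤0) =
    inj₂ (t₀ , t₀≥0 , (λ { zero → ≤-reflexive t₀a₀≡s₀ ; (suc j) → small (s≥0 (suc j)) (a≤0 j) })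
         , zero , a₀>0 , t₀a₀≡s₀)
  combine (inj₂ (t , t≥0 , ta≤s , j , aⱼ>0 , eq)) with t₀ ≤? t
  ... | yes t₀≤t = inj₂ (t₀ , t₀≥0 , below , zero , a₀>0 , t₀a₀≡s₀)
    where
    below : ∀ i → t₀ * a i ≤ s i
    below zero = ≤-reflexive t₀a₀≡s₀
    below (suc i) with a (suc i) ≤? 0ℚ
    ... | yes a≤0 = small (s≥0 (suc i)) a≤0
    ... | no a≰0  = ≤-by _
      (+-nonneg (p≤q⇒0≤q-p (ta≤s i)) (*-nonneg (p≤q⇒0≤q-p t₀≤t) (<⇒≤ (≰⇒> a≰0))))
      (eqn′ t t₀ (a (suc i)) (s (suc i)))
  ... | no t₀≰t = inj₂ (t , t≥0 , below , suc j , aⱼ>0 , eq)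
    where
    below : ∀ i → t * a i ≤ s i
    below zero = ≤-by _ (+-nonneg (p≤q⇒0≤q-p (≤-reflexive t₀a₀≡s₀))
      (*-nonneg (p≤q⇒0≤q-p (<⇒≤ (≰⇒> t₀≰t))) (<⇒≤ a₀>0))) (eqn′ t₀ t (a zero) (s zero))
    below (suc i) = ta≤s i

-- Finite sums and inner products

sum-cong : ∀ {n} {f g : Fin n → ℚ} → (∀ i → f i ≡ g i) → sumℚ f ≡ sumℚ g
sum-cong {zero}  e = refl
sum-cong {suc n} e = cong₂ _+_ (e zero) (sum-cong (e ∘ suc))

sum-0 : ∀ {n} {f : Fin n → ℚ} → (∀ i → f i ≡ 0ℚ) → sumℚ f ≡ 0ℚ
sum-0 {zero}  e = refl
sum-0 {suc n} e = cong₂ _+_ (e zero) (sum-0 (e ∘ suc))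

sum-+ : ∀ {n} (f g : Fin n → ℚ) → sumℚ (λ i → f i + g i) ≡ sumℚ f + sumℚ g
sum-+ {zero}  f g = refl
sum-+ {suc n} f g = trans (cong (f zero + g zero +_) (sum-+ (f ∘ suc) (g ∘ suc)))
  (swap (f zero) (g zero) (sumℚ (f ∘ suc)) (sumℚ (g ∘ suc)))
  where
  swap : ∀ a b c d → a + b + (c + d) ≡ (a + c) + (b + d)
  swap = solve-∀ ℚ-ring

sum-* : ∀ {n} t (f : Fin n → ℚ) → sumℚ (λ i → t * f i) ≡ t * sumℚ f
sum-* {zero}  t f = sym (ℚP.*-zeroʳ t)
sum-* {suc n} t f = trans (cong (t * f zero +_) (sum-* t (f ∘ suc)))
  (sym (ℚP.*-distribˡ-+ t (f zero) (sumℚ (f ∘ suc))))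

sum-swap : ∀ {k n} (f : Fin k → Fin n → ℚ) →
  sumℚ (λ i → sumℚ (f i)) ≡ sumℚ (λ j → sumℚ (λ i → f i j))
sum-swap {zero} {n} f = sym (sum-0 {n} {λ _ → 0ℚ} (λ _ → refl))
sum-swap {suc k} f = trans (cong (sumℚ (f zero) +_) (sum-swap (f ∘ suc)))
  (sym (sum-+ (f zero) (λ j → sumℚ (λ i → f (suc i) j))))

sum-mono : ∀ {n} {f g : Fin n → ℚ} → (∀ i → f i ≤ g i) → sumℚ f ≤ sumℚ g
sum-mono {zero}  h = ≤-refl
sum-mono {suc n} h = ℚP.+-mono-≤ (h zero) (sum-mono (h ∘ suc))

sum-mono-tight : ∀ {n} {f g : Fin n → ℚ} → (∀ i → f i ≤ g i) → sumℚ f ≡ sumℚ g → ∀ i → f i ≡ g i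
sum-mono-tight {suc n} {f} {g} h eq = λ { zero → eq₀ ; (suc i) → sum-mono-tight (h ∘ suc) eq₁ i }
  where
  eq₀ : f zero ≡ g zero
  eq₀ = ≡-stable λ ne →
    <⇒≢ (ℚP.+-mono-<-≤ (≤∧≢⇒< (h zero) ne) (sum-mono (h ∘ suc))) eq
  eq₁ : sumℚ (f ∘ suc) ≡ sumℚ (g ∘ suc)
  eq₁ = ≡-stable λ ne →
    <⇒≢ (ℚP.+-mono-≤-< (h zero) (≤∧≢⇒< (sum-mono (h ∘ suc)) ne)) eq

module _ {n : ℕ} where

  dot-cong : ∀ (c : Vecℚ n) {x y} → x ≈ y → dot c x ≡ dot c y
  dot-cong c e = sum-cong λ i → cong (c i *_) (e i)

  dot-comm : ∀ (c x : Vecℚ n) → dot c x ≡ dot x c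
  dot-comm c x = sum-cong λ i → ℚP.*-comm (c i) (x i)

  dot-⊕ : ∀ (c x y : Vecℚ n) → dot c (x ⊕ y) ≡ dot c x + dot c y
  dot-⊕ c x y = trans (sum-cong λ i → ℚP.*-distribˡ-+ (c i) (x i) (y i))
    (sum-+ (λ i → c i * x i) (λ i → c i * y i))

  dot-· : ∀ (c : Vecℚ n) t x → dot c (t · x) ≡ t * dot c x
  dot-· c t x = trans (sum-cong λ i → swap (c i) t (x i)) (sum-* t (λ i → c i * x i))
    where
    swap : ∀ a b c → a * (b * c) ≡ b * (a * c)
    swap = solve-∀ ℚ-ring

  dot-step : ∀ (c x : Vecℚ n) t h → dot c (x ⊕ t · h) ≡ dot c x + t * dot c h
  dot-step c x t h = trans (dot-⊕ c x (t · h)) (cong (dot c x +_) (dot-· c t h))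

  dot-stepˡ : ∀ (c x : Vecℚ n) t h → dot (x ⊕ t · h) c ≡ dot x c + t * dot h c
  dot-stepˡ c x t h = trans (dot-comm (x ⊕ t · h) c) (trans (dot-step c x t h)
    (cong₂ (λ a b → a + t * b) (dot-comm c x) (dot-comm c h)))

  dot-neg : ∀ (c x : Vecℚ n) → dot c (neg x) ≡ - dot c x
  dot-neg c x = trans (dot-cong c λ i → neg-* (x i)) (trans (dot-· c (- 1ℚ) x) (sym (neg-* (dot c x))))
    where
    neg-* : ∀ a → - a ≡ - 1ℚ * a
    neg-* = solve-∀ ℚ-ring

  dot-⊖ : ∀ (c x y : Vecℚ n) → dot c (x ⊖ y) ≡ dot c x - dot c y
  dot-⊖ c x y = trans (dot-⊕ c x (neg y)) (cong (dot c x +_) (dot-neg c y))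

  dot-zeroV : ∀ (c : Vecℚ n) {x} → x ≈ zeroV → dot c x ≡ 0ℚ
  dot-zeroV c e = sum-0 λ i → trans (cong (c i *_) (e i)) (ℚP.*-zeroʳ (c i))

  lincomb : ∀ {k} → (Fin k → ℚ) → (Fin k → Vecℚ n) → Vecℚ n
  lincomb l w j = sumℚ (λ i → l i * w i j)

  dot-lincomb : ∀ {k} c (l : Fin k → ℚ) (w : Fin k → Vecℚ n) →
    dot c (lincomb l w) ≡ sumℚ (λ i → l i * dot c (w i))
  dot-lincomb c l w = trans (sum-cong λ j → sym (sum-* (c j) (λ i → l i * w i j)))
    (trans (sum-swap (λ j i → c j * (l i * w i j)))
      (sum-cong λ i → trans (sum-cong λ j → swap (c j) (l i) (w i j)) (sum-* (l i) (λ j → c j * w i j))))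
    where
    swap : ∀ a b c → a * (b * c) ≡ b * (a * c)
    swap = solve-∀ ℚ-ring

  LinIndep : ∀ {k} → (Fin k → Vecℚ n) → Set
  LinIndep w = ∀ l → lincomb l w ≈ zeroV → ∀ i → l i ≡ 0ℚ

  ≈0-or-NonZeroV : (x : Vecℚ n) → x ≈ zeroV ⊎ NonZeroV x
  ≈0-or-NonZeroV x with FinP.any? (λ i → ¬? (x i ≟ 0ℚ))
  ... | yes nz = inj₂ nz
  ... | no ¬nz = inj₁ λ i → ≡-stable λ ne → ¬nz (i , ne)

  NonZeroV⇒≉0 : {x : Vecℚ n} → NonZeroV x → ¬ x ≈ zeroV
  NonZeroV⇒≉0 (i , xᵢ≢0) e = xᵢ≢0 (e i)

-- Homogeneous linear systems with more unknowns than equations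

-- One step of Gaussian elimination: `q` stands for the reciprocal of the pivot `M p zero`, and the
-- other rows lose their first column.
eliminate : ∀ {k} → (Fin (suc k) → Vecℚ (suc (suc k))) → Fin (suc k) → ℚ → Fin k → Vecℚ (suc k)
eliminate M p q s = (M (punchIn p s) ∘ suc) ⊕ (- (M (punchIn p s) zero * q)) · (M p ∘ suc)

infixr 5 _∷ᵛ_

_∷ᵛ_ : ∀ {k} → ℚ → Vecℚ k → Vecℚ (suc k)
(a ∷ᵛ x) zero    = a
(a ∷ᵛ x) (suc i) = x i

back-substitute : ∀ {k} (M : Fin (suc k) → Vecℚ (suc (suc k))) p q → M p zero * q ≡ 1ℚ →
  (l : Vecℚ (suc k)) → (∀ s → dot (eliminate M p q s) l ≡ 0ℚ) →
  ∀ r → dot (M r) (- (q * dot (M p ∘ suc) l) ∷ᵛ l) ≡ 0ℚ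
back-substitute M p q aq≡1 l sol r with p FinP.≟ r
... | yes refl = trans (shuffle (M p zero) q (dot (M p ∘ suc) l))
    (trans (cong (λ z → dot (M p ∘ suc) l - z * dot (M p ∘ suc) l) aq≡1)
      (cancel (dot (M p ∘ suc) l)))
  where
  shuffle : ∀ a q d → a * - (q * d) + d ≡ d - a * q * d
  shuffle = solve-∀ ℚ-ring
  cancel : ∀ d → d - 1ℚ * d ≡ 0ℚ
  cancel = solve-∀ ℚ-ring
... | no p≢r = subst (λ r → dot (M r) (- (q * dot (M p ∘ suc) l) ∷ᵛ l) ≡ 0ℚ)
    (FinP.punchIn-punchOut p≢r) (eliminated (punchOut p≢r))
  where
  shuffle : ∀ a q d e → a * - (q * d) + e ≡ e + - (a * q) * d
  shuffle = solve-∀ ℚ-ring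
  eliminated : ∀ s → dot (M (punchIn p s)) (- (q * dot (M p ∘ suc) l) ∷ᵛ l) ≡ 0ℚ
  eliminated s = trans (shuffle (M (punchIn p s) zero) q (dot (M p ∘ suc) l) (dot (M (punchIn p s) ∘ suc) l))
    (trans (sym (dot-stepˡ l (M (punchIn p s) ∘ suc) (- (M (punchIn p s) zero * q)) (M p ∘ suc))) (sol s))

kernel-vector : ∀ {k} (M : Fin k → Vecℚ (suc k)) →
  Σ (Vecℚ (suc k)) λ l → NonZeroV l × ∀ r → dot (M r) l ≡ 0ℚ
kernel-vector {zero}  M = (λ _ → 1ℚ) , (zero , ℚP.1≢0) , λ ()
kernel-vector {suc k} M with FinP.any? (λ r → ¬? (M r zero ≟ 0ℚ))
... | no none = 1ℚ ∷ᵛ zeroV , (zero , ℚP.1≢0) , λ r →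
  cong₂ _+_ (trans (ℚP.*-identityʳ (M r zero)) (≡-stable λ ne → none (r , ne)))
    (sum-0 {f = λ i → M r (suc i) * 0ℚ} λ i → ℚP.*-zeroʳ (M r (suc i)))
... | yes (p , piv≢0) =
  let q , aq≡1 = inverse piv≢0
      l , (i , lᵢ≢0) , sol = kernel-vector (eliminate M p q)
  in - (q * dot (M p ∘ suc) l) ∷ᵛ l , (suc i , lᵢ≢0) , back-substitute M p q aq≡1 l sol

-- The `k` conditions form a homogeneous system in the `suc k` coefficients; independence of `w`
-- keeps the combination from vanishing.
annihilated-combination : ∀ {n k} (f : Fin k → Vecℚ n) (w : Fin (suc k) → Vecℚ n) → LinIndep w →
  Σ (Fin (suc k) → ℚ) λ l → NonZeroV (lincomb l w) × ∀ r → dot (f r) (lincomb l w) ≡ 0ℚ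
annihilated-combination f w indep with kernel-vector (λ r i → dot (f r) (w i))
... | l , l≢0 , sol = l , nonzero (≈0-or-NonZeroV (lincomb l w)) , λ r →
    trans (dot-lincomb (f r) l w) (trans (dot-comm l (λ i → dot (f r) (w i))) (sol r))
  where
  nonzero : _ ⊎ _ → NonZeroV (lincomb l w)
  nonzero (inj₂ nz) = nz
  nonzero (inj₁ e)  = contradiction (indep l e) (NonZeroV⇒≉0 l≢0)

no-LinIndep : ∀ {n} (w : Fin (suc n) → Vecℚ n) → ¬ LinIndep w
no-LinIndep w indep with kernel-vector (λ r i → w i r)
... | l , l≢0 , sol = NonZeroV⇒≉0 l≢0 (indep l λ j → trans (dot-comm l (λ i → w i j)) (sol j))

-- Cardinality of a decidable set of indices

weight : ∀ {X : Set} → Dec X → ℕ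
weight (yes _) = 1
weight (no _)  = 0

count : ∀ {k} {P : Fin k → Set} → (∀ j → Dec (P j)) → ℕ
count {zero}  P? = 0
count {suc k} P? = weight (P? zero) ℕ.+ count (P? ∘ suc)

weight-≤ : ∀ {X Y : Set} (X? : Dec X) (Y? : Dec Y) → (X → Y) → weight X? ℕ.≤ weight Y?
weight-≤ (no _)  Y?      f = ℕ.z≤n
weight-≤ (yes x) (yes _) f = ℕP.≤-refl
weight-≤ (yes x) (no ¬y) f = contradiction (f x) ¬y

weight-< : ∀ {X Y : Set} (X? : Dec X) (Y? : Dec Y) → ¬ X → Y → weight X? ℕ.< weight Y?
weight-< (yes x) Y?      ¬x y = contradiction x ¬x
weight-< (no _)  (yes _) ¬x y = ℕP.≤-refl
weight-< (no _)  (no ¬y) ¬x y = contradiction y ¬y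

count-≤ : ∀ {k} {P Q : Fin k → Set} (P? : ∀ j → Dec (P j)) (Q? : ∀ j → Dec (Q j)) →
  (∀ j → P j → Q j) → count P? ℕ.≤ count Q?
count-≤ {zero}  P? Q? P⊆Q = ℕ.z≤n
count-≤ {suc k} P? Q? P⊆Q =
  ℕP.+-mono-≤ (weight-≤ (P? zero) (Q? zero) (P⊆Q zero)) (count-≤ (P? ∘ suc) (Q? ∘ suc) (P⊆Q ∘ suc))

count-< : ∀ {k} {P Q : Fin k → Set} (P? : ∀ j → Dec (P j)) (Q? : ∀ j → Dec (Q j)) →
  (∀ j → P j → Q j) → ∀ j → ¬ P j → Q j → count P? ℕ.< count Q?
count-< P? Q? P⊆Q zero    ¬Pj Qj = ℕP.+-mono-<-≤
  (weight-< (P? zero) (Q? zero) ¬Pj Qj) (count-≤ (P? ∘ suc) (Q? ∘ suc) (P⊆Q ∘ suc))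
count-< P? Q? P⊆Q (suc j) ¬Pj Qj = ℕP.+-mono-≤-<
  (weight-≤ (P? zero) (Q? zero) (P⊆Q zero)) (count-< (P? ∘ suc) (Q? ∘ suc) (P⊆Q ∘ suc) j ¬Pj Qj)


-- Clearing denominators

-- `_/_` normalises by a gcd and is stuck on variables, so the equation is checked among
-- unnormalised rationals.
/1-* : ∀ i j → (i ℤ.* j) / 1 ≡ (i / 1) * (j / 1)
/1-* i j = ℚP.toℚᵘ-injective (ℚᵘP.≃-trans (ℚP.toℚᵘ-fromℚᵘ (mkℚᵘ (i ℤ.* j) 0))
  (ℚᵘP.≃-sym (ℚᵘP.≃-trans (ℚP.toℚᵘ-homo-* (i / 1) (j / 1))
    (ℚᵘP.*-cong (ℚP.toℚᵘ-fromℚᵘ (mkℚᵘ i 0)) (ℚP.toℚᵘ-fromℚᵘ (mkℚᵘ j 0))))))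

↧-*-≡-↥ : ∀ x → (↧ x / 1) * x ≡ ↥ x / 1
↧-*-≡-↥ x = ℚP.toℚᵘ-injective (ℚᵘP.≃-trans (ℚP.toℚᵘ-homo-* (↧ x / 1) x)
  (ℚᵘP.≃-trans (ℚᵘP.*-congʳ (ℚP.toℚᵘ-fromℚᵘ (mkℚᵘ (↧ x) 0)))
    (ℚᵘP.≃-trans (clear x) (ℚᵘP.≃-sym (ℚP.toℚᵘ-fromℚᵘ (mkℚᵘ (↥ x) 0))))))
  where
  clear : ∀ x → mkℚᵘ (↧ x) 0 ℚᵘ.* toℚᵘ x ℚᵘ.≃ mkℚᵘ (↥ x) 0
  clear (mkℚ i k _) = ℚᵘ.*≡* (trans (ℤP.*-identityʳ _)
    (trans (ℤP.*-comm (int (suc k)) i) (cong (λ z → i ℤ.* int (suc z)) (sym (ℕP.+-identityʳ k)))))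

suc/1-pos : ∀ k → 0ℚ < int (suc k) / 1
suc/1-pos k = ℚP.positive⁻¹ (int (suc k) / 1) {{ℚP.normalize-pos (suc k) 1}}

nonzero-pos/1 : ∀ k → k ≢ 0 → 0ℚ < int k / 1
nonzero-pos/1 zero    k≢0 = contradiction refl k≢0
nonzero-pos/1 (suc k) _   = suc/1-pos k

-- `N` is the product of the denominators of all coordinates.
integral-multiple : ∀ {n} (x : Vecℚ n) →
  Σ ℤ λ N → 0ℚ < N / 1 × Σ (Fin n → ℤ) λ g → toℚ g ≈ (N / 1) · x
integral-multiple {zero}  x = int 1 , suc/1-pos 0 , (λ ()) , λ ()
integral-multiple {suc n} x with integral-multiple (x ∘ suc)
... | N , N>0 , g , g≈ = N ℤ.* D , subst (0ℚ <_) (sym (/1-* N D)) (*-pos N>0 (suc/1-pos (ℚ.denominator-1 (x zero)))) , g′ , eq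
  where
  D : ℤ
  D = ↧ (x zero)
  g′ : Fin (suc n) → ℤ
  g′ zero    = N ℤ.* ↥ (x zero)
  g′ (suc i) = D ℤ.* g i
  swap : ∀ a b c → a * (b * c) ≡ b * a * c
  swap = solve-∀ ℚ-ring
  eq : toℚ g′ ≈ ((N ℤ.* D) / 1) · x
  eq zero = trans (/1-* N (↥ (x zero))) (trans (cong (N / 1 *_) (sym (↧-*-≡-↥ (x zero))))
    (trans (sym (ℚP.*-assoc (N / 1) (D / 1) (x zero))) (cong (_* x zero) (sym (/1-* N D)))))
  eq (suc i) = trans (/1-* D (g i)) (trans (cong (D / 1 *_) (g≈ i))
    (trans (swap (D / 1) (N / 1) (x (suc i))) (cong (_* x (suc i)) (sym (/1-* N D)))))

module Geometry {n p m : ℕ}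
  (A : Fin p → Vecℚ n) (b : Fin p → ℚ) (B : Fin m → Vecℚ n) (d : Fin m → ℚ) where

  open Poly A b B d

  -- Dividing by a common divisor other than 1 strictly shrinks the nonzero coordinate `i`, whose
  -- absolute value bounds the recursion. The divisor is not 0 because that coordinate is not.
  primitive-multiple : ∀ N (g : Fin n → ℤ) i → ℤ.∣ g i ∣ ℕ.≤ N → ℤ.∣ g i ∣ ≢ 0 →
    ¬ ¬ (Σ (Fin n → ℤ) λ g′ → Coprime g′ × Σ ℚ λ t → 0ℚ < t × toℚ g′ ≈ t · toℚ g)
  primitive-multiple zero g i gᵢ≤0 gᵢ≢0 = contradiction (ℕP.n≤0⇒n≡0 gᵢ≤0) gᵢ≢0
  primitive-multiple (suc N) g i gᵢ≤N gᵢ≢0 = do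
    common? ← ¬¬-excluded-middle {A = Σ ℕ λ k → k ≢ 1 × ∀ i → k ∣ ℤ.∣ g i ∣}
    reduce common?
    where
    Goal = Σ (Fin n → ℤ) λ g′ → Coprime g′ × Σ ℚ λ t → 0ℚ < t × toℚ g′ ≈ t · toℚ g
    reduce : Dec (Σ ℕ λ k → k ≢ 1 × ∀ i → k ∣ ℤ.∣ g i ∣) → ¬ ¬ Goal
    reduce (no none) = return
      (g , (λ k k∣g → decidable-stable (k ℕ.≟ 1) λ k≢1 → none (k , k≢1 , k∣g)) ,
       1ℚ , 0<1 , λ i → sym (ℚP.*-identityˡ (toℚ g i)))
    reduce (yes (k , k≢1 , k∣g)) = do
      g′ , cop , t , t>0 , eq ← primitive-multiple N h i
        (ℕP.≤-pred (ℕP.≤-trans smaller gᵢ≤N)) hᵢ≢0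
      return (g′ , cop , t * r , *-pos t>0 r>0 , λ j →
        trans (eq j) (trans (cong (t *_) (unscale j)) (sym (ℚP.*-assoc t r (toℚ g j)))))
      where
      h : Fin n → ℤ
      h j = _∣ˢ_.quotient (∣ᵤ⇒∣ {int k} {g j} (k∣g j))
      g≡hk : ∀ j → g j ≡ h j ℤ.* int k
      g≡hk j = _∣ˢ_.equality (∣ᵤ⇒∣ {int k} {g j} (k∣g j))
      ∣g∣≡ : ℤ.∣ g i ∣ ≡ ℤ.∣ h i ∣ ℕ.* k
      ∣g∣≡ = trans (cong ℤ.∣_∣ (g≡hk i)) (ℤP.abs-* (h i) (int k))
      hᵢ≢0 : ℤ.∣ h i ∣ ≢ 0
      hᵢ≢0 e = gᵢ≢0 (trans ∣g∣≡ (cong (ℕ._* k) e))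
      k≢0 : k ≢ 0
      k≢0 e = gᵢ≢0 (trans ∣g∣≡ (trans (cong (ℤ.∣ h i ∣ ℕ.*_) e) (ℕP.*-zeroʳ ℤ.∣ h i ∣)))
      k>1 : 1 ℕ.< k
      k>1 = ℕP.≤∧≢⇒< (ℕP.n≢0⇒n>0 k≢0) (k≢1 ∘ sym)
      smaller : ℤ.∣ h i ∣ ℕ.< ℤ.∣ g i ∣
      smaller = subst (ℤ.∣ h i ∣ ℕ.<_) (sym ∣g∣≡)
        (ℕP.m<m*n ℤ.∣ h i ∣ k {{ℕ.≢-nonZero hᵢ≢0}} k>1)
      K>0 : 0ℚ < int k / 1
      K>0 = nonzero-pos/1 k k≢0
      r : ℚ
      r = proj₁ (pos-inverse K>0)
      r>0 : 0ℚ < r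
      r>0 = proj₁ (proj₂ (pos-inverse K>0))
      unscale : ∀ j → toℚ h j ≡ r * toℚ g j
      unscale j = scale-back (toℚ h j) (int k / 1) r (toℚ g j) (proj₂ (proj₂ (pos-inverse K>0)))
        (trans (cong (_/ 1) (g≡hk j)) (/1-* (h j) (int k)))
        where
        rearrange : ∀ h k r → r * (h * k) ≡ h * (k * r)
        rearrange = solve-∀ ℚ-ring
        scale-back : ∀ h k r g → k * r ≡ 1ℚ → g ≡ h * k → h ≡ r * g
        scale-back h k r g kr≡1 g≡ = sym (trans (cong (r *_) g≡) (trans (rearrange h k r)
          (trans (cong (h *_) kr≡1) (ℚP.*-identityʳ h))))

  coprime-multiple : ∀ x → NonZeroV x →
    ¬ ¬ (Σ (Fin n → ℤ) λ g → Coprime g × Σ ℚ λ t → 0ℚ < t × toℚ g ≈ t · x)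
  coprime-multiple x (i , xᵢ≢0) = do
    let N , N>0 , g , g≈ = integral-multiple x
    g′ , cop , t , t>0 , eq ← primitive-multiple ℤ.∣ g i ∣ g i ℕP.≤-refl
      (λ e → xᵢ≢0 (*-cancel-0 {N / 1} {x i} (pos≢0 N>0)
        (trans (sym (g≈ i)) (cong (_/ 1) (ℤP.∣i∣≡0⇒i≡0 {g i} e)))))
    return (g′ , cop , t * (N / 1) , *-pos t>0 N>0 , λ j →
      trans (eq j) (trans (cong (t *_) (g≈ j)) (sym (ℚP.*-assoc t (N / 1) (x j)))))

  -- Active constraints and steps inside P

  Active : Vecℚ n → Fin m → Set
  Active x j = dot (B j) x ≡ d j

  active? : ∀ x j → Dec (Active x j)
  active? x j = dot (B j) x ≟ d j

  InP-resp : ∀ {x y} → x ≈ y → InP x → InP y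
  InP-resp e (eqs , ineqs) =
    (λ i → trans (sym (dot-cong (A i) e)) (eqs i)) ,
    (λ j → subst (_≤ d j) (dot-cong (B j) e) (ineqs j))

  InKer-⊖ : ∀ {x y} → InP x → InP y → InKer (x ⊖ y)
  InKer-⊖ {x} {y} xP yP i = trans (dot-⊖ (A i) x y)
    (trans (cong₂ _-_ (proj₁ xP i) (proj₁ yP i)) (ℚP.+-inverseʳ (b i)))

  InKer-step : ∀ {x h} t → InKer x → InKer h → InKer (x ⊕ t · h)
  InKer-step {x} {h} t xK hK i = trans (dot-step (A i) x t h)
    (trans (cong₂ (λ a c → a + t * c) (xK i) (hK i)) (trans (ℚP.+-identityˡ (t * 0ℚ)) (ℚP.*-zeroʳ t)))

  InKer-· : ∀ {h} t → InKer h → InKer (t · h)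
  InKer-· {h} t hK i = trans (dot-· (A i) t h) (trans (cong (t *_) (hK i)) (ℚP.*-zeroʳ t))

  InKer-neg : ∀ {h} → InKer h → InKer (neg h)
  InKer-neg {h} hK i = trans (dot-neg (A i) h) (cong -_ (hK i))

  InKer-lincomb : ∀ {k} (l : Fin k → ℚ) {w : Fin k → Vecℚ n} → (∀ a → InKer (w a)) → InKer (lincomb l w)
  InKer-lincomb l {w} wK i = trans (dot-lincomb (A i) l w)
    (sum-0 {f = λ a → l a * dot (A i) (w a)} λ a → trans (cong (l a *_) (wK a i)) (ℚP.*-zeroʳ (l a)))

  slack : Vecℚ n → Fin m → ℚ
  slack x j = d j - dot (B j) x

  slack≥0 : ∀ {x} → InP x → ∀ j → 0ℚ ≤ slack x j
  slack≥0 xP j = p≤q⇒0≤q-p (proj₂ xP j)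

  private
    slack-eqn : ∀ d x t h → d - (x + t * h) ≡ (d - x) - t * h
    slack-eqn = solve-∀ ℚ-ring

  slack-step : ∀ x t h j → slack (x ⊕ t · h) j ≡ slack x j - t * dot (B j) h
  slack-step x t h j = trans (cong (λ z → d j - z) (dot-step (B j) x t h))
    (slack-eqn (d j) (dot (B j) x) t (dot (B j) h))

  slack≡0⇒active : ∀ x j → slack x j ≡ 0ℚ → Active x j
  slack≡0⇒active x j e = trans (sym (add-diff₂ (dot (B j) x) (d j)))
    (trans (cong (λ z → d j - z) e) (ℚP.+-identityʳ (d j)))
    where
    add-diff₂ : ∀ x d → d - (d - x) ≡ x
    add-diff₂ = solve-∀ ℚ-ring

  active⇒slack≡0 : ∀ x j → Active x j → slack x j ≡ 0ℚ
  active⇒slack≡0 x j e = trans (cong (λ z → d j - z) e) (ℚP.+-inverseʳ (d j))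

  InP-step : ∀ {x h} t → InP x → InKer h → (∀ j → t * dot (B j) h ≤ slack x j) → InP (x ⊕ t · h)
  InP-step {x} {h} t xP hK le =
    (λ i → trans (dot-step (A i) x t h) (trans (cong₂ (λ a c → a + t * c) (proj₁ xP i) (hK i))
      (trans (cong (b i +_) (ℚP.*-zeroʳ t)) (ℚP.+-identityʳ (b i))))) ,
    (λ j → ≤-by _ (p≤q⇒0≤q-p (le j)) (slack-step x t h j))

  step-bound : ∀ x t h → InP (x ⊕ t · h) → ∀ j → t * dot (B j) h ≤ slack x j
  step-bound x t h yP j = ≤-by _ (slack≥0 yP j) (sym (slack-step x t h j))

  feasible-active : ∀ {x h t} → 0ℚ < t → InP (x ⊕ t · h) → ∀ j → Active x j → dot (B j) h ≤ 0ℚ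
  feasible-active {x} {h} {t} t>0 yP j act = 0≤-p⇒p≤0 (*-cancel-nonneg t>0
    (subst (0ℚ ≤_) (neg-out t (dot (B j) h))
      (p≤0⇒0≤-p (subst (t * dot (B j) h ≤_) (active⇒slack≡0 x j act) (step-bound x t h yP j)))))
    where
    neg-out : ∀ t h → - (t * h) ≡ t * - h
    neg-out = solve-∀ ℚ-ring

  InP⇒InKer : ∀ {x h t} → 0ℚ < t → InP x → InP (x ⊕ t · h) → InKer h
  InP⇒InKer {x} {h} {t} t>0 xP yP i = *-cancel-0 (pos≢0 t>0)
    (trans (drop (b i) (t * dot (A i) h))
      (trans (cong (λ z → z - b i) (trans (cong (_+ t * dot (A i) h) (sym (proj₁ xP i)))
        (trans (sym (dot-step (A i) x t h)) (proj₁ yP i)))) (ℚP.+-inverseʳ (b i))))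
    where
    drop : ∀ b x → x ≡ b + x - b
    drop = solve-∀ ℚ-ring

  -- For `x` in P this is the cone of feasible directions, by `small-step` in one direction and by
  -- `InP⇒InKer` and `feasible-active` in the other.
  Feasible : Vecℚ n → Vecℚ n → Set
  Feasible x h = InKer h × ∀ j → Active x j → dot (B j) h ≤ 0ℚ

  private
    -- The row that limits the step increases along `h`, so it is not active at `x` and has positive
    -- slack.
    ratio-pos : ∀ {x h t} → Feasible x h → 0ℚ ≤ t →
      ∀ j → 0ℚ < dot (B j) h → t * dot (B j) h ≡ slack x j → 0ℚ < t
    ratio-pos {x} {h} {t} (hK , hA) t≥0 j pos eq = ≤∧≢⇒< t≥0 λ 0≡t →
      <-irrefl refl (<-≤-trans pos (hA j (slack≡0⇒active x j
        (trans (sym eq) (trans (cong (_* dot (B j) h) (sym 0≡t)) (ℚP.*-zeroˡ (dot (B j) h)))))))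

  small-step : ∀ {x h} → InP x → Feasible x h → Σ ℚ λ t → 0ℚ < t × InP (x ⊕ t · h)
  small-step {x} {h} xP hF with max-ratio (λ j → dot (B j) h) (slack x) (slack≥0 xP)
  ... | inj₁ Bh≤0 = 1ℚ , 0<1 , InP-step 1ℚ xP (proj₁ hF) λ j →
    ≤-trans (subst (_≤ 0ℚ) (sym (ℚP.*-identityˡ (dot (B j) h))) (Bh≤0 j)) (slack≥0 xP j)
  ... | inj₂ (t , t≥0 , th≤s , j , pos , eq) =
    t , ratio-pos hF t≥0 j pos eq , InP-step t xP (proj₁ hF) th≤s

  module _ (bounded : Bounded) where

    -- P would contain a whole ray. The step along it is chosen so that a coordinate with `h i`
    -- nonzero ends exactly 1 outside the interval from `- M` to `M`.
    no-recession : ∀ {x h} → InP x → InKer h → NonZeroV h → ¬ (∀ j → dot (B j) h ≤ 0ℚ)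
    no-recession {x} {h} xP hK (i , hᵢ≢0) Bh≤0 = go (<-cmp (h i) 0ℚ)
      where
      M : ℚ
      M = proj₁ bounded
      lower : ∀ {x} → InP x → 0ℚ ≤ x i - - M
      lower yP = p≤q⇒0≤q-p (proj₁ (proj₂ bounded _ yP i))
      upper : ∀ {x} → InP x → 0ℚ ≤ M - x i
      upper yP = p≤q⇒0≤q-p (proj₂ (proj₂ bounded _ yP i))
      ray : ∀ t → 0ℚ ≤ t → InP (x ⊕ t · h)
      ray t t≥0 = InP-step t xP hK λ j → ≤-by _
        (+-nonneg (slack≥0 xP j) (*-nonneg t≥0 (p≤0⇒0≤-p (Bh≤0 j))))
        (eqn (slack x j) t (dot (B j) h))
        where
        eqn : ∀ s t h → s - t * h ≡ s + t * - h
        eqn = solve-∀ ℚ-ring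
      negative-one : ¬ 0ℚ ≤ - 1ℚ
      negative-one 0≤-1 = <-irrefl refl (<-≤-trans (ℚP.negative⁻¹ (- 1ℚ)) 0≤-1)
      up : ∀ M x h q → h * q ≡ 1ℚ → M - (x + (M - x + 1ℚ) * q * h) ≡ - 1ℚ
      up M x h q e = trans (eqn M x h q) (trans (cong (λ z → (M - x) - (M - x + 1ℚ) * z) e) (eqn′ (M - x)))
        where
        eqn : ∀ M x h q → M - (x + (M - x + 1ℚ) * q * h) ≡ (M - x) - (M - x + 1ℚ) * (h * q)
        eqn = solve-∀ ℚ-ring
        eqn′ : ∀ a → a - (a + 1ℚ) * 1ℚ ≡ - 1ℚ
        eqn′ = solve-∀ ℚ-ring
      down : ∀ M x h q → - h * q ≡ 1ℚ → (x + (x - - M + 1ℚ) * q * h) - - M ≡ - 1ℚ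
      down M x h q e = trans (eqn M x h q) (trans (cong (λ z → (x - - M) - (x - - M + 1ℚ) * z) e) (eqn′ (x - - M)))
        where
        eqn : ∀ M x h q → (x + (x - - M + 1ℚ) * q * h) - - M ≡ (x - - M) - (x - - M + 1ℚ) * (- h * q)
        eqn = solve-∀ ℚ-ring
        eqn′ : ∀ a → a - (a + 1ℚ) * 1ℚ ≡ - 1ℚ
        eqn′ = solve-∀ ℚ-ring
      go : _ → ⊥
      go (tri≈ _ hᵢ≡0 _) = hᵢ≢0 hᵢ≡0
      go (tri> _ _ hᵢ>0) =
        let q , q>0 , hq≡1 = pos-inverse hᵢ>0
        in negative-one (subst (0ℚ ≤_) (up M (x i) (h i) q hq≡1)
          (upper (ray ((M - x i + 1ℚ) * q) (*-nonneg (+-nonneg (upper xP) (<⇒≤ 0<1)) (<⇒≤ q>0)))))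
      go (tri< hᵢ<0 _ _) =
        let q , q>0 , hq≡1 = pos-inverse (p<0⇒0<-p hᵢ<0)
        in negative-one (subst (0ℚ ≤_) (down M (x i) (h i) q hq≡1)
          (lower (ray ((x i - - M + 1ℚ) * q) (*-nonneg (+-nonneg (lower xP) (<⇒≤ 0<1)) (<⇒≤ q>0)))))

    max-step : ∀ {x h} → InP x → NonZeroV h → Feasible x h →
      Σ ℚ λ t → 0ℚ < t × InP (x ⊕ t · h) × Σ (Fin m) λ j → 0ℚ < dot (B j) h × Active (x ⊕ t · h) j
    max-step {x} {h} xP h≢0 hF with max-ratio (λ j → dot (B j) h) (slack x) (slack≥0 xP)
    ... | inj₁ Bh≤0 = contradiction Bh≤0 (no-recession xP (proj₁ hF) h≢0)
    ... | inj₂ (t , t≥0 , th≤s , j , pos , eq) =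
      t , ratio-pos hF t≥0 j pos eq , InP-step t xP (proj₁ hF) th≤s , j , pos ,
      slack≡0⇒active _ j (trans (slack-step x t h j)
        (trans (cong (λ z → slack x j - z) eq) (ℚP.+-inverseʳ (slack x j))))

    -- A direction on which all rows vanish would be a recession direction.
    support-nonempty : ∀ {x h} → InP x → InKer h → NonZeroV h → Σ (Fin m) λ j → Supp h j
    support-nonempty {x} {h} xP hK h≢0 with FinP.any? (λ j → ¬? (dot (B j) h ≟ 0ℚ))
    ... | yes s  = s
    ... | no ¬s = contradiction (λ j → ≤-reflexive (≡-stable λ ne → ¬s (j , ne)))
      (no-recession xP hK h≢0)

  beyond-blocked : ∀ {x h t} j → 0ℚ < dot (B j) h → Active (x ⊕ t · h) j →
    ∀ t′ → t < t′ → ¬ InP (x ⊕ t′ · h)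
  beyond-blocked {x} {h} {t} j pos act t′ t<t′ yP = <-irrefl refl (<-≤-trans
    (*-pos (p<q⇒0<q-p t<t′) pos)
    (subst (_≤ 0ℚ) (eqn t′ t (dot (B j) h) (slack x j))
      (≤-trans (ℚP.+-monoˡ-≤ (- (t * dot (B j) h)) (step-bound x t′ h yP j))
        (≤-reflexive (trans (sym (slack-step x t h j)) (active⇒slack≡0 _ j act))))))
    where
    eqn : ∀ t′ t h s → t′ * h - t * h ≡ (t′ - t) * h
    eqn = solve-∀ ℚ-ring

  -- Vertices and faces

  -- Both `h` and `neg h` can be followed for a short step inside P, and `c` exceeds its maximum `δ`
  -- along neither.
  FaceSet-normal : ∀ {c δ x h} → Valid c δ → FaceSet c δ x → InKer h →
    (∀ j → Active x j → dot (B j) h ≡ 0ℚ) → dot c h ≡ 0ℚ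
  FaceSet-normal {c} {δ} {x} {h} valid (xP , cx≡δ) hK hA = ≤-antisym
    (one-sided h hK λ j act → ≤-reflexive (hA j act))
    (-p≤0⇒0≤p (subst (_≤ 0ℚ) (dot-neg c h) (one-sided (neg h) (InKer-neg hK)
      λ j act → ≤-reflexive (trans (dot-neg (B j) h) (cong -_ (hA j act))))))
    where
    one-sided : ∀ h → InKer h → (∀ j → Active x j → dot (B j) h ≤ 0ℚ) → dot c h ≤ 0ℚ
    one-sided h hK hA with small-step xP (hK , hA)
    ... | t , t>0 , yP = 0≤-p⇒p≤0 (*-cancel-nonneg t>0 (subst (0ℚ ≤_)
      (trans (cong (λ z → z - (dot c x + t * dot c h)) (sym cx≡δ)) (eqn (dot c x) t (dot c h)))
      (p≤q⇒0≤q-p (subst (_≤ δ) (dot-step c x t h) (valid _ yP)))))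
      where
      eqn : ∀ x t h → x - (x + t * h) ≡ t * - h
      eqn = solve-∀ ℚ-ring

  -- The basic feasible solutions of linear programming; `IsVertex⇒Basic` and `Basic⇒IsVertex`
  -- identify them with the vertices.
  Basic : Vecℚ n → Set
  Basic x = InP x × ∀ {h} → InKer h → (∀ j → Active x j → dot (B j) h ≡ 0ℚ) → h ≈ zeroV

  IsVertex⇒Basic : ∀ {v} → IsVertex v → Basic v
  IsVertex⇒Basic {v} (c , δ , valid , ⊆face , face⊆) = proj₁ vF , λ {h} hK hA →
    let t , t>0 , yP = small-step (proj₁ vF) (hK , λ j act → ≤-reflexive (hA j act))
        ch≡0 = FaceSet-normal {c} {δ} valid vF hK hA
        y≈v = face⊆ (v ⊕ t · h) (yP , trans (dot-step c v t h)
          (trans (cong₂ (λ a z → a + t * z) (proj₂ vF) ch≡0)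
            (trans (cong (δ +_) (ℚP.*-zeroʳ t)) (ℚP.+-identityʳ δ))))
    in λ i → *-cancel-0 (pos≢0 t>0) (trans (drop (v i) (t * h i))
      (trans (cong (λ z → z - v i) (y≈v i)) (ℚP.+-inverseʳ (v i))))
    where
    vF : FaceSet c δ v
    vF = ⊆face v λ _ → refl
    drop : ∀ b x → x ≡ b + x - b
    drop = solve-∀ ℚ-ring

  TightFace : (Fin m → Set) → Pred n
  TightFace T x = InP x × ∀ j → T j → Active x j

  -- The supporting functional is the sum of the rows in `T`: a sum of inequalities is tight only if
  -- each of them is.
  TightFace-isFace : ∀ {T} → (∀ j → Dec (T j)) → IsFace (TightFace T)
  TightFace-isFace {T} T? = c , δ , valid ,
    (λ x (xP , tight) → xP , trans (dot-c x) (sum-cong λ j → ind-tight (T? j) (tight j))) ,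
    (λ x (xP , cx≡δ) → xP , λ j Tj → ind-cancel (T? j) Tj
      (sum-mono-tight (λ j → ind-mono (T? j) (proj₂ xP j)) (trans (sym (dot-c x)) cx≡δ) j))
    where
    ind : ∀ {j} → Dec (T j) → ℚ
    ind (yes _) = 1ℚ
    ind (no _)  = 0ℚ
    l : Fin m → ℚ
    l j = ind (T? j)
    c : Vecℚ n
    c = lincomb l B
    δ : ℚ
    δ = sumℚ λ j → l j * d j
    dot-c : ∀ x → dot c x ≡ sumℚ (λ j → l j * dot (B j) x)
    dot-c x = trans (dot-comm c x) (trans (dot-lincomb x l B)
      (sum-cong λ j → cong (l j *_) (dot-comm x (B j))))
    ind-mono : ∀ {j} (T?j : Dec (T j)) {a e} → a ≤ e → ind T?j * a ≤ ind T?j * e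
    ind-mono (yes _) le = subst₂ _≤_ (sym (ℚP.*-identityˡ _)) (sym (ℚP.*-identityˡ _)) le
    ind-mono (no _) {a} {e} le = subst₂ _≤_ (sym (ℚP.*-zeroˡ a)) (sym (ℚP.*-zeroˡ e)) ≤-refl
    ind-tight : ∀ {j} (T?j : Dec (T j)) {a e} → (T j → a ≡ e) → ind T?j * a ≡ ind T?j * e
    ind-tight (yes Tj) eq = cong (1ℚ *_) (eq Tj)
    ind-tight (no _) {a} {e} eq = trans (ℚP.*-zeroˡ a) (sym (ℚP.*-zeroˡ e))
    ind-cancel : ∀ {j} (T?j : Dec (T j)) {a e} → T j → ind T?j * a ≡ ind T?j * e → a ≡ e
    ind-cancel (yes _) {a} {e} Tj eq = trans (sym (ℚP.*-identityˡ a)) (trans eq (ℚP.*-identityˡ e))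
    ind-cancel (no ¬Tj) Tj eq = contradiction Tj ¬Tj
    valid : Valid c δ
    valid x xP = subst (_≤ δ) (sym (dot-c x)) (sum-mono λ j → ind-mono (T? j) (proj₂ xP j))

  IsFace-resp : ∀ {F G} → F ≐ G → IsFace G → IsFace F
  IsFace-resp (F⊆G , G⊆F) (c , δ , valid , G⊆ , ⊆G) =
    c , δ , valid , (λ x → G⊆ x ∘ F⊆G x) , (λ x → G⊆F x ∘ ⊆G x)

  Basic⇒IsVertex : ∀ {v} → Basic v → IsVertex v
  Basic⇒IsVertex {v} (vP , ker) = IsFace-resp (to , from) (TightFace-isFace (active? v))
    where
    to : (λ x → x ≈ v) ⊆ TightFace (Active v)
    to x x≈v = InP-resp (λ i → sym (x≈v i)) vP , λ j act → trans (dot-cong (B j) x≈v) act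
    from : TightFace (Active v) ⊆ (λ x → x ≈ v)
    from x (xP , tight) i = trans (back (x i) (v i)) (trans (cong (_+ v i)
      (ker (InKer-⊖ xP vP) (λ j act → trans (dot-⊖ (B j) x v)
        (trans (cong₂ _-_ (tight j act) act) (ℚP.+-inverseʳ (d j)))) i)) (ℚP.+-identityˡ (v i)))
      where
      back : ∀ x v → x ≡ x - v + v
      back = solve-∀ ℚ-ring

  -- Dimension

  -- Affinely independent families are enlarged while possible. In `climb`, `fuel + k` is `suc n`,
  -- so running out of fuel would give `suc n` independent vectors of length `n`.
  rank-exists : ∀ {S : Pred n} {x} → S x → ¬ ¬ (Σ ℕ λ k → Rank S (suc k))
  rank-exists {S} {x} Sx =
    climb (suc n) 0 (ℕP.+-identityʳ (suc n)) (x , (λ ()) , Sx , (λ ()) , λ _ _ ())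
    where
    climb : ∀ fuel k → fuel ℕ.+ k ≡ suc n → HasAffIndep S (suc k) → ¬ ¬ (Σ ℕ λ k → Rank S (suc k))
    climb zero k refl (p₀ , p , _ , _ , indep) = contradiction indep (no-LinIndep (λ a → p a ⊖ p₀))
    climb (suc fuel) k eq has = ¬¬-excluded-middle {A = HasAffIndep S (suc (suc k))} >>= λ where
      (yes has′) → climb fuel (suc k) (trans (ℕP.+-suc fuel k) eq) has′
      (no ¬has′) → return (k , has , ¬has′)

  -- If P had dimension 0, its facets would have rank 0 and be empty, whereas `x` lies on the facet
  -- of row `i`.
  positive-rank : MinimalRep → ∀ {x} i → InP x → Active x i → ¬ ¬ (Σ ℕ λ k → Rank InP (suc (suc k)))
  positive-rank minimal {x} i xP act = rank-exists xP >>= λ where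
    (zero , rank) → contradiction (x , (λ ()) , (xP , act) , (λ ()) , λ _ _ ())
      (proj₂ (proj₂ (minimal i) 0 rank))
    (suc k , rank) → return (k , rank)

  -- The slack of a midpoint is the mean of two slacks, hence positive once either is. The family
  -- `r` lets the induction add one row at a time.
  combine-slack : (∀ j → Σ (Vecℚ n) λ x → InP x × dot (B j) x < d j) → ∀ {x₀} → InP x₀ →
    ∀ {k} (r : Fin k → Fin m) → Σ (Vecℚ n) λ x → InP x × ∀ a → dot (B (r a)) x < d (r a)
  combine-slack pts {x₀} x₀P {zero}  r = x₀ , x₀P , λ ()
  combine-slack pts {x₀} x₀P {suc k} r with combine-slack pts x₀P (r ∘ suc) | pts (r zero)
  ... | x , xP , x< | y , yP , y< = x ⊕ ½ · (y ⊖ x) ,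
    InP-step ½ xP (InKer-⊖ yP xP) (λ j → ≤-by _
      (*-nonneg (<⇒≤ 0<½) (+-nonneg (slack≥0 xP j) (slack≥0 yP j)))
      (trans (cong (λ z → slack x j - ½ * z) (dot-⊖ (B j) y x)) (eqn (d j) (dot (B j) x) (dot (B j) y)))) ,
    λ { zero → mix (r zero) (subst (0ℚ <_) (ℚP.+-comm (slack y (r zero)) (slack x (r zero)))
          (+-pos (p<q⇒0<q-p y<) (slack≥0 xP (r zero))))
      ; (suc a) → mix (r (suc a)) (+-pos (p<q⇒0<q-p (x< a)) (slack≥0 yP (r (suc a)))) }
    where
    eqn : ∀ d x y → (d - x) - ½ * (y - x) ≡ ½ * ((d - x) + (d - y))
    eqn = solve-∀ ℚ-ring
    mix : ∀ j → 0ℚ < slack x j + slack y j → dot (B j) (x ⊕ ½ · (y ⊖ x)) < d j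
    mix j pos = <-by _ (*-pos 0<½ pos) (trans (slack-step x ½ (y ⊖ x) j)
      (trans (cong (λ z → slack x j - ½ * z) (dot-⊖ (B j) y x)) (eqn (d j) (dot (B j) x) (dot (B j) y))))

  -- On ker A, row `j` is a multiple of row `i`, possibly zero; this form avoids naming the factor.
  Determines : Fin m → Fin m → Set
  Determines i j = ∀ {h} → InKer h → dot (B i) h ≡ 0ℚ → dot (B j) h ≡ 0ℚ

  -- e spans the edge at u that leaves the facet of row i, scaled so that no inverse is needed in strip below.
  -- A facet may be given by several rows; these determine one another.
  EdgeAt : Vecℚ n → Fin m → Vecℚ n → Set
  EdgeAt u i e = InKer e × dot (B i) e ≡ - 1ℚ ×
    ∀ j → Active u j → dot (B j) e ≡ 0ℚ ⊎ Determines i j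

  module _ {u i e} (edge : EdgeAt u i e) where

    -- Removes the summand of `h` along `e`: as row `i` is -1 on `e`, the coefficient of that
    -- summand is `- dot (B i) h`.
    strip : Vecℚ n → Vecℚ n
    strip h = h ⊕ dot (B i) h · e

    dot-strip : ∀ c h → dot c (strip h) ≡ dot c h + dot (B i) h * dot c e
    dot-strip c h = dot-step c h (dot (B i) h) e

    strip-InKer : ∀ {h} → InKer h → InKer (strip h)
    strip-InKer {h} hK = InKer-step (dot (B i) h) hK (proj₁ edge)

    strip-leaving : ∀ h → dot (B i) (strip h) ≡ 0ℚ
    strip-leaving h = trans (dot-strip (B i) h)
      (trans (cong (λ z → dot (B i) h + dot (B i) h * z) (proj₁ (proj₂ edge))) (eqn (dot (B i) h)))
      where
      eqn : ∀ x → x + x * - 1ℚ ≡ 0ℚ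
      eqn = solve-∀ ℚ-ring

    strip-active : ∀ {h} → InKer h → ∀ j → Active u j →
      dot (B j) (strip h) ≡ dot (B j) h ⊎ dot (B j) (strip h) ≡ 0ℚ
    strip-active {h} hK j act with proj₂ (proj₂ edge) j act
    ... | inj₁ Be≡0 = inj₁ (trans (dot-strip (B j) h)
      (trans (cong (λ z → dot (B j) h + dot (B i) h * z) Be≡0)
        (trans (cong (dot (B j) h +_) (ℚP.*-zeroʳ (dot (B i) h))) (ℚP.+-identityʳ (dot (B j) h)))))
    ... | inj₂ det = inj₂ (det (strip-InKer hK) (strip-leaving h))

    -- Row `j` is determined by row `i` and so vanishes on `strip h`, which makes `dot (B j) h` a
    -- nonzero multiple of `dot (B i) h`.
    Determines-leaving : ∀ j → Active u j → dot (B j) e ≢ 0ℚ → Determines j i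
    Determines-leaving j act Be≢0 {h} hK Bjh≡0 with proj₂ (proj₂ edge) j act
    ... | inj₁ Be≡0 = contradiction Be≡0 Be≢0
    ... | inj₂ det  = *-cancel-0 Be≢0 (trans (eqn (dot (B j) e) (dot (B i) h))
      (trans (cong (_+ dot (B i) h * dot (B j) e) (sym Bjh≡0))
        (trans (sym (dot-strip (B j) h)) (det (strip-InKer hK) (strip-leaving h)))))
      where
      eqn : ∀ a c → a * c ≡ 0ℚ + c * a
      eqn = solve-∀ ℚ-ring

  -- Rank exceeds dimension by one: P has dimension `suc k` and its facets have dimension `k`.
  module Dimension (minimal : MinimalRep) {k : ℕ} (rank : Rank InP (suc (suc k))) where

    private
      p₀ : Vecℚ n
      p₀ = proj₁ (proj₁ rank)
      ps : Fin (suc k) → Vecℚ n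
      ps = proj₁ (proj₂ (proj₁ rank))
      p₀P : InP p₀
      p₀P = proj₁ (proj₂ (proj₂ (proj₁ rank)))
      psP : ∀ a → InP (ps a)
      psP = proj₁ (proj₂ (proj₂ (proj₂ (proj₁ rank))))
      ps-indep : LinIndep (λ a → ps a ⊖ p₀)
      ps-indep = proj₂ (proj₂ (proj₂ (proj₂ (proj₁ rank))))

    -- A row tight at all points of a maximal independent family of P would give its facet the rank
    -- of P.
    not-tight : ∀ j → Σ (Vecℚ n) λ x → InP x × dot (B j) x < d j
    not-tight j with active? p₀ j | FinP.all? (λ a → active? (ps a) j)
    ... | no ¬act | _       = p₀ , p₀P , ≤∧≢⇒< (proj₂ p₀P j) ¬act
    ... | yes act | yes all = contradiction
      (p₀ , ps , (p₀P , act) , (λ a → psP a , all a) , ps-indep) (proj₂ (proj₂ (minimal j) (suc k) rank))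
    ... | yes _   | no ¬all =
      let a , ¬act = FinP.¬∀⟶∃¬ (suc k) _ (λ a → active? (ps a) j) ¬all
      in ps a , psP a , ≤∧≢⇒< (proj₂ (psP a) j) ¬act

    interior : Σ (Vecℚ n) λ z → InP z × ∀ j → dot (B j) z < d j
    interior = combine-slack not-tight p₀P λ j → j

    private
      z : Vecℚ n
      z = proj₁ interior
      zP : InP z
      zP = proj₁ (proj₂ interior)
      z< : ∀ j → dot (B j) z < d j
      z< = proj₂ (proj₂ interior)

    -- k + 2 independent directions, scaled to stay in P from an interior point, would exceed its rank.
    InKer-dependent : (w : Fin (suc (suc k)) → Vecℚ n) → (∀ a → InKer (w a)) → ¬ LinIndep w
    InKer-dependent w wK indep = proj₂ rank
      (z , (λ a → z ⊕ t a · w a) , zP , (λ a → proj₂ (proj₂ (step a))) , shifted-indep)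
      where
      step : ∀ a → Σ ℚ λ t → 0ℚ < t × InP (z ⊕ t · w a)
      step a = small-step zP (wK a , λ j act → contradiction act (<⇒≢ (z< j)))
      t : Fin (suc (suc k)) → ℚ
      t a = proj₁ (step a)
      eqn : ∀ l z t w → l * t * w ≡ l * (z + t * w - z)
      eqn = solve-∀ ℚ-ring
      shifted-indep : LinIndep (λ a → (z ⊕ t a · w a) ⊖ z)
      shifted-indep l e a = *-cancel-0 (pos≢0 (proj₁ (proj₂ (step a)))) (trans (ℚP.*-comm (t a) (l a))
        (indep (λ a → l a * t a) (λ j → trans (sum-cong λ a → eqn (l a) (z j) (t a) (w a j)) (e j)) a))

    -- Were row `j` nonzero on `h`, then `h`, `z ⊖ q₀` and the `k` differences within the facet
    -- would be too many independent directions. In a linear relation among them row `i` kills the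
    -- coefficient of `z ⊖ q₀`, then row `j` that of `h`, and the rest is the independence of the
    -- `q a`.
    common-hull⇒Determines : ∀ i j q₀ (q : Fin k → Vecℚ n) → AffIndep q₀ q → InP q₀ → (∀ a → InP (q a)) →
      Active q₀ i → (∀ a → Active (q a) i) → Active q₀ j → (∀ a → Active (q a) j) → Determines i j
    common-hull⇒Determines i j q₀ q indep q₀P qP q₀i qi q₀j qj {h} hK Bih≡0 =
      ≡-stable λ Bjh≢0 → InKer-dependent w wK (w-indep Bjh≢0)
      where
      w : Fin (suc (suc k)) → Vecℚ n
      w zero          = h
      w (suc zero)    = z ⊖ q₀
      w (suc (suc a)) = q a ⊖ q₀
      wK : ∀ a → InKer (w a)
      wK zero          = hK
      wK (suc zero)    = InKer-⊖ zP q₀P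
      wK (suc (suc a)) = InKer-⊖ (qP a) q₀P
      rest-0 : ∀ {r} → Active q₀ r → (∀ a → Active (q a) r) → (l : Fin k → ℚ) →
        sumℚ (λ a → l a * dot (B r) (q a ⊖ q₀)) ≡ 0ℚ
      rest-0 {r} q₀r qr l = sum-0 {f = λ a → l a * dot (B r) (q a ⊖ q₀)} λ a →
        trans (cong (l a *_) (trans (dot-⊖ (B r) (q a) q₀)
          (trans (cong₂ _-_ (qr a) q₀r) (ℚP.+-inverseʳ (d r))))) (ℚP.*-zeroʳ (l a))
      Biz≢0 : dot (B i) (z ⊖ q₀) ≢ 0ℚ
      Biz≢0 e = <⇒≢ (z< i) (trans (sym q-q) q₀i)
        where
        add : ∀ z q → z - q + q ≡ z
        add = solve-∀ ℚ-ring
        q-q : dot (B i) q₀ ≡ dot (B i) z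
        q-q = trans (sym (ℚP.+-identityˡ _)) (trans (cong (_+ dot (B i) q₀)
          (trans (sym e) (dot-⊖ (B i) z q₀))) (add (dot (B i) z) (dot (B i) q₀)))
      w-indep : dot (B j) h ≢ 0ℚ → LinIndep w
      w-indep Bjh≢0 l e = λ { zero → l₀≡0 ; (suc zero) → l₁≡0 ; (suc (suc a)) → indep l′ rest a }
        where
        l′ : Fin k → ℚ
        l′ a = l (suc (suc a))
        row : ∀ r → l zero * dot (B r) h + (l (suc zero) * dot (B r) (z ⊖ q₀) +
          sumℚ (λ a → l′ a * dot (B r) (q a ⊖ q₀))) ≡ 0ℚ
        row r = trans (sym (dot-lincomb (B r) l w)) (dot-zeroV (B r) e)
        first : ∀ a x c y s → x ≡ 0ℚ → s ≡ 0ℚ → a * x + (c * y + s) ≡ 0ℚ → y * c ≡ 0ℚ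
        first a _ c y _ refl refl eq = trans (eqn a c y) eq
          where
          eqn : ∀ a c y → y * c ≡ a * 0ℚ + (c * y + 0ℚ)
          eqn = solve-∀ ℚ-ring
        second : ∀ a x c y s → c ≡ 0ℚ → s ≡ 0ℚ → a * x + (c * y + s) ≡ 0ℚ → x * a ≡ 0ℚ
        second a x _ y _ refl refl eq = trans (eqn a x y) eq
          where
          eqn : ∀ a x y → x * a ≡ a * x + (0ℚ * y + 0ℚ)
          eqn = solve-∀ ℚ-ring
        third : ∀ a x c y s → a ≡ 0ℚ → c ≡ 0ℚ → a * x + (c * y + s) ≡ 0ℚ → s ≡ 0ℚ
        third _ x _ y s refl refl eq = trans (eqn x y s) eq
          where
          eqn : ∀ x y s → s ≡ 0ℚ * x + (0ℚ * y + s)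
          eqn = solve-∀ ℚ-ring
        l₁≡0 : l (suc zero) ≡ 0ℚ
        l₁≡0 = *-cancel-0 Biz≢0
          (first (l zero) (dot (B i) h) (l (suc zero)) (dot (B i) (z ⊖ q₀)) _ Bih≡0 (rest-0 q₀i qi l′) (row i))
        l₀≡0 : l zero ≡ 0ℚ
        l₀≡0 = *-cancel-0 Bjh≢0
          (second (l zero) (dot (B j) h) (l (suc zero)) (dot (B j) (z ⊖ q₀)) _ l₁≡0 (rest-0 q₀j qj l′) (row j))
        rest : lincomb l′ (λ a → q a ⊖ q₀) ≈ zeroV
        rest c = third (l zero) (h c) (l (suc zero)) ((z ⊖ q₀) c) _ l₀≡0 l₁≡0 (e c)

    facet-points : ∀ j → HasAffIndep (IneqFace j) (suc k)
    facet-points j = proj₁ (proj₂ (minimal j) (suc k) rank)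

    facet-⊆⇒Determines : ∀ i j → IneqFace i ⊆ IneqFace j → Determines i j
    facet-⊆⇒Determines i j i⊆j with facet-points i
    ... | q₀ , q , q₀F , qF , indep = common-hull⇒Determines i j q₀ q indep (proj₁ q₀F) (proj₁ ∘ qF)
      (proj₂ q₀F) (proj₂ ∘ qF) (proj₂ (i⊆j q₀ q₀F)) (λ a → proj₂ (i⊆j (q a) (qF a)))

    -- Among the independent points of facet `j` one is off facet `i`. Otherwise row `i` would
    -- determine row `j`, and `u`, which agrees with `q₀` in row `i`, would be active in row `j` as
    -- well.
    separating-point : ∀ {u} i j → InP u → Active u i → ¬ Active u j →
      Σ (Vecℚ n) λ x → IneqFace j x × dot (B i) x < d i
    separating-point {u} i j uP ui ¬uj with facet-points j
    ... | q₀ , q , q₀F , qF , indep with active? q₀ i | FinP.all? (λ a → active? (q a) i)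
    ...   | no ¬act | _ = q₀ , q₀F , ≤∧≢⇒< (proj₂ (proj₁ q₀F) i) ¬act
    ...   | yes _ | no ¬all =
      let a , ¬act = FinP.¬∀⟶∃¬ k _ (λ a → active? (q a) i) ¬all
      in q a , qF a , ≤∧≢⇒< (proj₂ (proj₁ (qF a)) i) ¬act
    ...   | yes q₀i | yes qi = contradiction (trans (sym (add (dot (B j) u) (dot (B j) q₀)))
        (trans (cong (_+ dot (B j) q₀) (trans (sym (dot-⊖ (B j) u q₀))
          (common-hull⇒Determines i j q₀ q indep (proj₁ q₀F) (proj₁ ∘ qF) q₀i qi (proj₂ q₀F) (proj₂ ∘ qF)
            (InKer-⊖ uP (proj₁ q₀F)) (trans (dot-⊖ (B i) u q₀)
              (trans (cong₂ _-_ ui q₀i) (ℚP.+-inverseʳ (d i)))))))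
          (trans (ℚP.+-identityˡ _) (proj₂ q₀F)))) ¬uj
      where
      add : ∀ z q → z - q + q ≡ z
      add = solve-∀ ℚ-ring

    -- A row that is active at `u` and determined by row `i` is a positive multiple of it on ker A,
    -- because both are negative on the direction from `u` to the interior point.
    EdgeAt-feasible : ∀ {u i e} → InP u → Active u i → EdgeAt u i e → Feasible u e
    EdgeAt-feasible {u} {i} {e} uP ui edge = proj₁ edge , below
      where
      towards : ∀ j → Active u j → 0ℚ < - dot (B j) (z ⊖ u)
      towards j uj = subst (0ℚ <_) (trans (eqn (d j) (dot (B j) z))
        (cong -_ (trans (cong (λ y → dot (B j) z - y) (sym uj)) (sym (dot-⊖ (B j) z u)))))
        (p<q⇒0<q-p (z< j))
        where
        eqn : ∀ d z → d - z ≡ - (z - d)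
        eqn = solve-∀ ℚ-ring
      below : ∀ j → Active u j → dot (B j) e ≤ 0ℚ
      below j uj with proj₂ (proj₂ edge) j uj
      ... | inj₁ Be≡0 = ≤-reflexive Be≡0
      ... | inj₂ det = 0≤-p⇒p≤0 (*-cancel-nonneg (towards i ui)
        (subst (0ℚ ≤_) (solve-for (dot (B j) (z ⊖ u)) (dot (B i) (z ⊖ u)) (dot (B j) e)
          (trans (sym (dot-strip edge (B j) (z ⊖ u)))
            (det (strip-InKer edge (InKer-⊖ zP uP)) (strip-leaving edge (z ⊖ u)))))
          (<⇒≤ (towards j uj))))
        where
        solve-for : ∀ a x y → a + x * y ≡ 0ℚ → - a ≡ - x * - y
        solve-for a x y eq = trans (eqn a x y) (trans (cong (λ w → x * y - w) eq) (eqn′ x y))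
          where
          eqn : ∀ a x y → - a ≡ x * y - (a + x * y)
          eqn = solve-∀ ℚ-ring
          eqn′ : ∀ x y → x * y - 0ℚ ≡ - x * - y
          eqn′ = solve-∀ ℚ-ring

    annihilated-direction : (f : Fin k → Vecℚ n) →
      Σ (Vecℚ n) λ h → InKer h × NonZeroV h × ∀ r → dot (f r) h ≡ 0ℚ
    annihilated-direction f = span (annihilated-combination f (λ a → ps a ⊖ p₀) ps-indep)
      where
      span : (Σ (Fin (suc k) → ℚ) λ l → NonZeroV (lincomb l (λ a → ps a ⊖ p₀)) ×
          ∀ r → dot (f r) (lincomb l (λ a → ps a ⊖ p₀)) ≡ 0ℚ) →
        Σ (Vecℚ n) λ h → InKer h × NonZeroV h × ∀ r → dot (f r) h ≡ 0ℚ
      span (l , h≢0 , fh≡0) =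
        lincomb l (λ a → ps a ⊖ p₀) , InKer-lincomb l (λ a → InKer-⊖ (psP a) p₀P) , h≢0 , fh≡0

    -- Simplicity leaves only k facets to keep tight, one fewer than the dimension of ker A.
    edge-exists : Simple → ∀ {u i} → Basic u → Active u i → ¬ ¬ (Σ (Vecℚ n) (EdgeAt u i))
    edge-exists simple {u} {i} basic ui = do
      row ← ¬¬-choice representative
      return (from-rows row (annihilated-direction λ s → proj₁ (row (punchIn cᵢ s))))
      where
      facets = simple u (Basic⇒IsVertex basic) (suc k) rank
      F : Fin (suc k) → Pred n
      F = proj₁ facets
      class : ∀ j → Active u j → Σ (Fin (suc k)) λ c → IneqFace j ≐ F c
      class j uj = proj₂ (proj₂ (proj₂ facets)) (IneqFace j) (minimal j) (proj₁ basic , uj)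
      cᵢ : Fin (suc k)
      cᵢ = proj₁ (class i ui)
      same-class : ∀ i j c → IneqFace i ≐ F c → IneqFace j ≐ F c → Determines i j
      same-class i j c (i⊆ , _) (_ , ⊆j) = facet-⊆⇒Determines i j λ x → ⊆j x ∘ i⊆ x
      Representative : Fin (suc k) → Set
      Representative c = Σ (Vecℚ n) λ f → ∀ j → Active u j → IneqFace j ≐ F c →
        ∀ {h} → InKer h → dot f h ≡ 0ℚ → dot (B j) h ≡ 0ℚ
      pick : ∀ c → Dec (Σ (Fin m) λ j → Active u j × IneqFace j ≐ F c) → Representative c
      pick c (yes (j₀ , _ , j₀c)) = B j₀ , λ j _ jc → same-class j₀ j c j₀c jc
      -- A facet given by no active row imposes no condition, so any functional represents it.
      pick c (no none) = zeroV , λ j uj jc → contradiction (j , uj , jc) none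
      representative : ∀ c → ¬ ¬ Representative c
      representative c = ¬¬-excluded-middle >>= λ found → return (pick c found)
      build : ∀ h → InKer h → NonZeroV h →
        (∀ j (uj : Active u j) → cᵢ ≢ proj₁ (class j uj) → dot (B j) h ≡ 0ℚ) → Σ (Vecℚ n) (EdgeAt u i)
      build h hK h≢0 others = - q · h , InKer-· (- q) hK ,
        trans (dot-· (B i) (- q) h) (trans (eqn q (dot (B i) h)) (cong -_ Bihq≡1)) , kept
        where
        split : ∀ j → Active u j → Determines i j ⊎ dot (B j) h ≡ 0ℚ
        split j uj = by (cᵢ FinP.≟ proj₁ (class j uj))
          where
          by : Dec (cᵢ ≡ proj₁ (class j uj)) → Determines i j ⊎ dot (B j) h ≡ 0ℚ
          by (yes eq) = inj₁ (same-class i j cᵢ (proj₂ (class i ui))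
            (subst (λ c → IneqFace j ≐ F c) (sym eq) (proj₂ (class j uj))))
          by (no neq) = inj₂ (others j uj neq)
        -- Otherwise every row active at `u` vanishes on `h`: those in the class of `i` because row
        -- `i` determines them, the others by the choice of `h`.
        Bih≢0 : dot (B i) h ≢ 0ℚ
        Bih≢0 Bih≡0 = NonZeroV⇒≉0 h≢0 (proj₂ basic hK vanish)
          where
          vanish : ∀ j → Active u j → dot (B j) h ≡ 0ℚ
          vanish j uj = [ (λ det → det hK Bih≡0) , (λ e → e) ]′ (split j uj)
        q : ℚ
        q = proj₁ (inverse Bih≢0)
        Bihq≡1 : dot (B i) h * q ≡ 1ℚ
        Bihq≡1 = proj₂ (inverse Bih≢0)
        eqn : ∀ q x → - q * x ≡ - (x * q)
        eqn = solve-∀ ℚ-ring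
        kept : ∀ j → Active u j → dot (B j) (- q · h) ≡ 0ℚ ⊎ Determines i j
        kept j uj = [ inj₂ , (λ Bjh≡0 → inj₁ (trans (dot-· (B j) (- q) h)
          (trans (cong (- q *_) Bjh≡0) (ℚP.*-zeroʳ (- q))))) ]′ (split j uj)
      from-rows : (row : ∀ c → Representative c) →
        (Σ (Vecℚ n) λ h → InKer h × NonZeroV h × ∀ s → dot (proj₁ (row (punchIn cᵢ s))) h ≡ 0ℚ) →
        Σ (Vecℚ n) (EdgeAt u i)
      from-rows row (h , hK , h≢0 , fh≡0) = build h hK h≢0 λ j uj cᵢ≢c →
        proj₂ (row (proj₁ (class j uj))) j uj (proj₂ (class j uj)) hK
          (subst (λ c → dot (proj₁ (row c)) h ≡ 0ℚ) (FinP.punchIn-punchOut cᵢ≢c) (fh≡0 (punchOut cᵢ≢c)))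

  -- Circuits and circuit walks

  supp? : ∀ x j → Dec (Supp x j)
  supp? x j = ¬? (dot (B j) x ≟ 0ℚ)

  ¬Supp⇒≡0 : ∀ {x} j → ¬ Supp x j → dot (B j) x ≡ 0ℚ
  ¬Supp⇒≡0 j = ≡-stable

  minimal-support : (S : Pred n) → ∀ {x} → S x → ¬ ¬ (Σ (Vecℚ n) λ x → S x ×
    ∀ {y} → S y → (∀ j → Supp y j → Supp x j) → ∀ j → Supp x j → Supp y j)
  minimal-support S {x} Sx = descend (count (supp? x)) x Sx ℕP.≤-refl
    where
    Smaller : Vecℚ n → Set
    Smaller x = Σ (Vecℚ n) λ y → S y × (∀ j → Supp y j → Supp x j) × Σ (Fin m) λ j → Supp x j × ¬ Supp y j
    Minimal : Vecℚ n → Set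
    Minimal x = S x × ∀ {y} → S y → (∀ j → Supp y j → Supp x j) → ∀ j → Supp x j → Supp y j
    descend : ∀ N x → S x → count (supp? x) ℕ.≤ N → ¬ ¬ Σ (Vecℚ n) Minimal
    continue : ∀ N x → S x → count (supp? x) ℕ.≤ N → Dec (Smaller x) → ¬ ¬ Σ (Vecℚ n) Minimal
    descend N x Sx le = ¬¬-excluded-middle >>= continue N x Sx le
    continue N x Sx le (no none) = return (x , Sx , λ {y} Sy y⊆x j xj yj≡0 →
      none (y , Sy , y⊆x , j , xj , λ yj → yj yj≡0))
    continue zero x Sx le (yes (y , Sy , y⊆x , j , xj , ¬yj)) = contradiction
      (ℕP.≤-trans (count-< (supp? y) (supp? x) y⊆x j ¬yj xj) le) λ ()
    continue (suc N) x Sx le (yes (y , Sy , y⊆x , j , xj , ¬yj)) =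
      descend N y Sy (ℕP.≤-pred (ℕP.≤-trans (count-< (supp? y) (supp? x) y⊆x j ¬yj xj) le))

  -- The circuit condition without integrality and coprimality, hence invariant under nonzero
  -- scaling.
  SupportMinimal : Vecℚ n → Set
  SupportMinimal x = InKer x × NonZeroV x × (∀ y → InKer y → NonZeroV y →
    (∀ j → Supp y j → Supp x j) → ∀ j → Supp x j → Supp y j)

  Supp-unscale : ∀ {x y t} → y ≈ t · x → ∀ j → Supp y j → Supp x j
  Supp-unscale {x} {y} {t} y≈tx j yj xj≡0 = yj (trans (dot-cong (B j) y≈tx)
    (trans (dot-· (B j) t x) (trans (cong (t *_) xj≡0) (ℚP.*-zeroʳ t))))

  SupportMinimal-scale : ∀ {x y t} → t ≢ 0ℚ → y ≈ t · x → SupportMinimal x → SupportMinimal y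
  SupportMinimal-scale {x} {y} {t} t≢0 y≈tx (xK , (i , xᵢ≢0) , min) =
    (λ r → trans (dot-cong (A r) y≈tx) (InKer-· t xK r)) ,
    (i , λ yᵢ≡0 → xᵢ≢0 (*-cancel-0 t≢0 (trans (sym (y≈tx i)) yᵢ≡0))) ,
    λ w wK w≢0 w⊆y j yj → min w wK w≢0
      (λ j wj → Supp-unscale {x} {y} {t} y≈tx j (w⊆y j wj)) j (Supp-unscale {x} {y} {t} y≈tx j yj)

  circuit-multiple : ∀ {x} → SupportMinimal x →
    ¬ ¬ (Σ (Fin n → ℤ) λ g → IsCircuit g × Σ ℚ λ t → 0ℚ < t × toℚ g ≈ t · x)
  circuit-multiple {x} xM = coprime-multiple x (proj₁ (proj₂ xM)) >>= λ (g , cop , t , t>0 , g≈) →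
    let gK , g≢0 , min = SupportMinimal-scale {x} {toℚ g} {t} (pos≢0 t>0) g≈ xM
    in return (g , (gK , g≢0 , cop , min) , t , t>0 , g≈)

  -- Continuing circuit walks to a vertex

  prepend : ∀ {k} → Vecℚ n → (Fin (suc k) → Vecℚ n) → Fin (suc (suc k)) → Vecℚ n
  prepend x ys zero    = x
  prepend x ys (suc i) = ys i

  walk-prepend : ∀ {x v k ys} {g : Fin n → ℤ} {t} → InP x → IsCircuit g → 0ℚ < t →
    (∀ t′ → t < t′ → ¬ InP (x ⊕ t′ · toℚ g)) →
    IsCircuitWalk (x ⊕ t · toℚ g) v k ys → IsCircuitWalk x v (suc k) (prepend x ys)
  walk-prepend {x} {v} {k} {ys} {g} {t} xP circ t>0 blocked (start , end , inside , steps) =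
    (λ _ → refl) , end ,
    (λ { zero → xP ; (suc i) → inside i }) ,
    λ { zero → g , t , circ , t>0 , start , blocked ; (suc i) → steps i }

  inactive? : ∀ x j → Dec (¬ Active x j)
  inactive? x j = ¬? (active? x j)

  -- The functional `c` steers the walk: with a row for `c`, a start off the facet of that row leads
  -- to a vertex off it.
  VertexBelow : Vecℚ n → Vecℚ n → Set
  VertexBelow c y = Σ (Vecℚ n) λ v → Basic v × (∀ j → Active y j → Active v j) × dot c v ≤ dot c y ×
    Σ ℕ λ k → Σ (Fin (suc k) → Vecℚ n) λ ys → IsCircuitWalk y v k ys

  Tangent : Vecℚ n → Vecℚ n → Set
  Tangent y h = InKer h × NonZeroV h × ∀ j → Active y j → dot (B j) h ≡ 0ℚ

  -- A point that is no vertex has a direction on which all active rows vanish. A circuit of this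
  -- kind, oriented so that `c` does not grow, is followed as far as possible: the active rows stay
  -- active and the blocking row joins them.
  walk-to-vertex : Bounded → ∀ c {y} → InP y → ¬ ¬ VertexBelow c y
  walk-to-vertex bounded c {y} yP = descend (count (inactive? y)) y yP ℕP.≤-refl
    where
    descend : ∀ N y → InP y → count (inactive? y) ℕ.≤ N → ¬ ¬ VertexBelow c y
    continue : ∀ N y → InP y → count (inactive? y) ℕ.≤ N → Dec (Σ (Vecℚ n) (Tangent y)) → ¬ ¬ VertexBelow c y
    step : ∀ N y → InP y → count (inactive? y) ℕ.≤ N →
      ∀ {x} → SupportMinimal x → (∀ j → Active y j → dot (B j) x ≡ 0ℚ) → dot c x ≤ 0ℚ → ¬ ¬ VertexBelow c y
    follow : ∀ N y → InP y → count (inactive? y) ℕ.≤ N → (g : Fin n → ℤ) → IsCircuit g →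
      (∀ j → Active y j → dot (B j) (toℚ g) ≡ 0ℚ) → dot c (toℚ g) ≤ 0ℚ →
      (Σ ℚ λ t → 0ℚ < t × InP (y ⊕ t · toℚ g) ×
        Σ (Fin m) λ j → 0ℚ < dot (B j) (toℚ g) × Active (y ⊕ t · toℚ g) j) → ¬ ¬ VertexBelow c y
    descend N y yP le = ¬¬-excluded-middle >>= continue N y yP le
    continue N y yP le (no none) = return (y , (yP , λ {h} → kernel-trivial {h}) , (λ j act → act) , ≤-refl ,
      0 , (λ _ → y) , (λ _ → refl) , (λ _ → refl) , (λ _ → yP) , λ ())
      where
      kernel-trivial : ∀ {h} → InKer h → (∀ j → Active y j → dot (B j) h ≡ 0ℚ) → h ≈ zeroV
      kernel-trivial {h} hK hA = [ (λ e → e) , (λ h≢0 → contradiction (h , hK , h≢0 , hA) none) ]′ (≈0-or-NonZeroV h)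
    continue N y yP le (yes (h , hT)) =
      minimal-support (Tangent y) hT >>= λ (x , (xK , x≢0 , xA) , min) →
      -- A direction supported within the support of `x` also vanishes on the active rows, so
      -- minimality among tangent directions is minimality in ker A.
      let xM : SupportMinimal x
          xM = xK , x≢0 , λ w wK w≢0 w⊆x → min (wK , w≢0 , λ j yj →
            ¬Supp⇒≡0 {w} j λ wj → w⊆x j wj (xA j yj)) w⊆x
          neg-xA : ∀ j → Active y j → dot (B j) (neg x) ≡ 0ℚ
          neg-xA j yj = trans (dot-neg (B j) x) (cong -_ (xA j yj))
      in [ (λ cx≤0 → step N y yP le {x} xM xA cx≤0)
         , (λ 0≤cx → step N y yP le {neg x} (SupportMinimal-scale {x} {neg x} { - 1ℚ} (λ ()) (λ i → neg-* (x i)) xM) neg-xA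
             (subst (_≤ 0ℚ) (sym (dot-neg c x)) (0≤p⇒-p≤0 0≤cx))) ]′ (ℚP.≤-total (dot c x) 0ℚ)
      where
      neg-* : ∀ a → - a ≡ - 1ℚ * a
      neg-* = solve-∀ ℚ-ring
    step N y yP le {x} xM xA cx≤0 = circuit-multiple xM >>= λ (g , circ , s , s>0 , g≈) →
      let gA : ∀ j → Active y j → dot (B j) (toℚ g) ≡ 0ℚ
          gA j yj = trans (dot-cong (B j) g≈) (trans (dot-· (B j) s x) (trans (cong (s *_) (xA j yj)) (ℚP.*-zeroʳ s)))
      in follow N y yP le g circ gA
        (subst (_≤ 0ℚ) (sym (trans (dot-cong c g≈) (dot-· c s x))) (0≤-p⇒p≤0
          (subst (0ℚ ≤_) (neg-out s (dot c x)) (*-nonneg (<⇒≤ s>0) (p≤0⇒0≤-p cx≤0)))))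
        (max-step bounded yP (proj₁ (proj₂ circ)) (proj₁ circ , λ j yj → ≤-reflexive (gA j yj)))
      where
      neg-out : ∀ s x → s * - x ≡ - (s * x)
      neg-out = solve-∀ ℚ-ring
    follow N y yP le g circ gA cg≤0 (t , t>0 , y′P , j , pos , act) = rec N le
      where
      y′ : Vecℚ n
      y′ = y ⊕ t · toℚ g
      kept : ∀ j → Active y j → Active y′ j
      kept j yj = trans (dot-step (B j) y t (toℚ g)) (trans (cong (λ z → dot (B j) y + t * z) (gA j yj))
        (trans (cong (dot (B j) y +_) (ℚP.*-zeroʳ t)) (trans (ℚP.+-identityʳ (dot (B j) y)) yj)))
      fewer : count (inactive? y′) ℕ.< count (inactive? y)
      fewer = count-< (inactive? y′) (inactive? y) (λ j ¬y′j yj → ¬y′j (kept j yj)) j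
        (λ ¬act → ¬act act) λ yj → pos≢0 pos (gA j yj)
      down : dot c y′ ≤ dot c y
      down = ≤-by _ (*-nonneg (<⇒≤ t>0) (p≤0⇒0≤-p cg≤0))
        (trans (cong (λ z → dot c y - z) (dot-step c y t (toℚ g))) (eqn (dot c y) t (dot c (toℚ g))))
        where
        eqn : ∀ y t g → y - (y + t * g) ≡ t * - g
        eqn = solve-∀ ℚ-ring
      extend : VertexBelow c y′ → VertexBelow c y
      extend (v , basic , v⊇y′ , cv≤ , k , ys , walk) = v , basic , (λ j → v⊇y′ j ∘ kept j) ,
        ≤-trans cv≤ down , suc k , prepend y ys ,
        walk-prepend {y} {v} {k} {ys} {g} {t} yP circ t>0 (beyond-blocked {y} {toℚ g} {t} j pos act) walk
      rec : ∀ N → count (inactive? y) ℕ.≤ N → ¬ ¬ VertexBelow c y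
      rec zero    le = contradiction (ℕP.≤-trans fewer le) λ ()
      rec (suc N) le = do
        below ← descend N y′ y′P (ℕP.≤-pred (ℕP.≤-trans fewer le))
        return (extend below)

  -- Cones of feasible directions at a vertex

  edge-exists′ : MinimalRep → Simple → ∀ {u i} → Basic u → Active u i →
    ¬ ¬ (Σ (Vecℚ n) λ e → EdgeAt u i e × Feasible u e)
  edge-exists′ minimal simple {u} {i} basic ui = do
    rank ← positive-rank minimal i (proj₁ basic) ui
    edge ← Dimension.edge-exists minimal (proj₂ rank) simple basic ui
    return (proj₁ edge , proj₂ edge , Dimension.EdgeAt-feasible minimal (proj₂ rank) (proj₁ basic) ui (proj₂ edge))

  leaving? : ∀ u h i → Dec (Active u i × dot (B i) h < 0ℚ)
  leaving? u h i = active? u i ×-dec (dot (B i) h <? 0ℚ)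

  not-leaving⇒0 : ∀ {u h} → Basic u → Feasible u h →
    ¬ (Σ (Fin m) λ i → Active u i × dot (B i) h < 0ℚ) → h ≈ zeroV
  not-leaving⇒0 basic (hK , hA) none = proj₂ basic hK λ i ui →
    ≤-antisym (hA i ui) (≮⇒≥ λ neg → none (i , ui , neg))

  strip-feasible : ∀ {u i e h} (edge : EdgeAt u i e) → Feasible u h → Feasible u (strip edge h)
  strip-feasible {u} {i} {e} {h} edge (hK , hA) = strip-InKer edge hK , λ j uj →
    [ (λ eq → subst (_≤ 0ℚ) (sym eq) (hA j uj)) , ≤-reflexive ]′ (strip-active edge hK j uj)

  -- Every feasible direction is a nonnegative combination of the edge directions it leaves along.
  cone-nonneg : MinimalRep → Simple → ∀ {u} → Basic u → ∀ j {h} → Feasible u h →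
    (∀ i → Active u i → dot (B i) h < 0ℚ → ∀ e → EdgeAt u i e → Feasible u e → 0ℚ ≤ dot (B j) e) →
    0ℚ ≤ dot (B j) h
  cone-nonneg minimal simple {u} basic j {h} hF edges≥0 =
    ≤-stable (descend (count (leaving? u h)) h hF edges≥0 ℕP.≤-refl)
    where
    EdgesNonneg : Vecℚ n → Set
    EdgesNonneg h = ∀ i → Active u i → dot (B i) h < 0ℚ →
      ∀ e → EdgeAt u i e → Feasible u e → 0ℚ ≤ dot (B j) e
    descend : ∀ N h → Feasible u h → EdgesNonneg h → count (leaving? u h) ℕ.≤ N → ¬ ¬ (0ℚ ≤ dot (B j) h)
    continue : ∀ N h → Feasible u h → EdgesNonneg h → count (leaving? u h) ℕ.≤ N →
      Dec (Σ (Fin m) λ i → Active u i × dot (B i) h < 0ℚ) → ¬ ¬ (0ℚ ≤ dot (B j) h)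
    peel : ∀ N h → Feasible u h → EdgesNonneg h → count (leaving? u h) ℕ.≤ N →
      ∀ i → Active u i → dot (B i) h < 0ℚ →
      (Σ (Vecℚ n) λ e → EdgeAt u i e × Feasible u e) → ¬ ¬ (0ℚ ≤ dot (B j) h)
    descend N h hF h≥0 le = continue N h hF h≥0 le (FinP.any? (leaving? u h))
    continue N h hF h≥0 le (no none) =
      return (≤-reflexive (sym (dot-zeroV (B j) {h} (not-leaving⇒0 basic hF none))))
    continue N h hF h≥0 le (yes (i , ui , Bih<0)) =
      edge-exists′ minimal simple basic ui >>= peel N h hF h≥0 le i ui Bih<0
    peel N h hF h≥0 le i ui Bih<0 (e , edge , eF) = rec N le
      where
      h′ : Vecℚ n
      h′ = strip edge h
      leaving-⊆ : ∀ j → Active u j × dot (B j) h′ < 0ℚ → Active u j × dot (B j) h < 0ℚ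
      leaving-⊆ j (uj , Bh′<0) = uj ,
        [ (λ eq → subst (_< 0ℚ) eq Bh′<0) , (λ eq → contradiction eq (<⇒≢ Bh′<0)) ]′
          (strip-active edge (proj₁ hF) j uj)
      -- Stripping creates no new leaving row and stops row `i` from leaving.
      fewer : count (leaving? u h′) ℕ.< count (leaving? u h)
      fewer = count-< (leaving? u h′) (leaving? u h) leaving-⊆ i
        (λ (_ , Bh′<0) → <⇒≢ Bh′<0 (strip-leaving edge h)) (ui , Bih<0)
      eqn : ∀ a c e → a - 0ℚ ≡ (a + c * e) + - c * e
      eqn = solve-∀ ℚ-ring
      add-back : 0ℚ ≤ dot (B j) h′ → 0ℚ ≤ dot (B j) h
      add-back Bh′≥0 = ≤-by _ (+-nonneg (subst (0ℚ ≤_) (dot-strip edge (B j) h) Bh′≥0)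
        (*-nonneg (<⇒≤ (p<0⇒0<-p Bih<0)) (h≥0 i ui Bih<0 e edge eF)))
        (eqn (dot (B j) h) (dot (B i) h) (dot (B j) e))
      rec : ∀ N → count (leaving? u h) ℕ.≤ N → ¬ ¬ (0ℚ ≤ dot (B j) h)
      rec zero    le = contradiction (ℕP.≤-trans fewer le) λ ()
      rec (suc N) le = descend N h′ (strip-feasible edge hF)
        (λ i′ ui′ Bh′<0 → h≥0 i′ ui′ (proj₂ (leaving-⊆ i′ (ui′ , Bh′<0))))
        (ℕP.≤-pred (ℕP.≤-trans fewer le)) >>= λ Bh′≥0 → return (add-back Bh′≥0)

  -- The rows that are active at `u` and constant along `g` leave only the line through `u` in
  -- direction `g`.
  SpansEdge : Vecℚ n → Vecℚ n → Set
  SpansEdge u g = ∀ {h} → InKer h → (∀ j → Active u j → dot (B j) g ≡ 0ℚ → dot (B j) h ≡ 0ℚ) →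
    Σ ℚ λ s → h ≈ s · g

  leaving-row : ∀ {u g} → Basic u → Feasible u g → NonZeroV g →
    Σ (Fin m) λ i → Active u i × dot (B i) g < 0ℚ
  leaving-row {u} {g} basic gF g≢0 = by (FinP.any? (leaving? u g))
    where
    by : Dec (Σ (Fin m) λ i → Active u i × dot (B i) g < 0ℚ) → Σ (Fin m) λ i → Active u i × dot (B i) g < 0ℚ
    by (yes l)   = l
    by (no none) = contradiction (not-leaving⇒0 basic gF none) (NonZeroV⇒≉0 g≢0)

  -- A row leaving along `g` determines the coefficient as a quotient of two row values. Only
  -- equations between rationals then depend on the doubly negated hypothesis.
  SpansEdge-stable : ∀ {u g} → Basic u → Feasible u g → NonZeroV g → ¬ ¬ SpansEdge u g → SpansEdge u g
  SpansEdge-stable {u} {g} basic gF g≢0 ¬¬spans {h} hK hA = dot (B i) h * r , λ c →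
    ≡-stable (¬¬spans >>= λ spans → return (coefficient c (spans hK hA)))
    where
    i : Fin m
    i = proj₁ (leaving-row basic gF g≢0)
    Big<0 : dot (B i) g < 0ℚ
    Big<0 = proj₂ (proj₂ (leaving-row basic gF g≢0))
    r : ℚ
    r = proj₁ (inverse (<⇒≢ Big<0))
    rearrange : ∀ s a r → s * (a * r) ≡ s * a * r
    rearrange = solve-∀ ℚ-ring
    coefficient : ∀ c → (Σ ℚ λ s → h ≈ s · g) → h c ≡ (dot (B i) h * r) * g c
    coefficient c (s , h≈sg) = trans (h≈sg c) (cong (_* g c) (trans (sym (ℚP.*-identityʳ s))
      (trans (cong (s *_) (sym (proj₂ (inverse (<⇒≢ Big<0)))))
        (trans (rearrange s (dot (B i) g) r)
          (cong (_* r) (sym (trans (dot-cong (B i) h≈sg) (dot-· (B i) s g))))))))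

  Basic-resp : ∀ {x y} → x ≈ y → Basic x → Basic y
  Basic-resp x≈y (xP , ker) = InP-resp x≈y xP , λ hK hA →
    ker hK λ j xj → hA j (trans (sym (dot-cong (B j) x≈y)) xj)

  -- The rows active at `u` and constant along `g` cut out the segment: `spans` puts their common
  -- points on the line, a leaving row bounds the parameter below by 0, and a row blocking at `y`
  -- bounds it above by `t`. Without a blocking row a further small step would contradict
  -- maximality. The blocking row also makes `y` a vertex.
  IsEdge-step : ∀ {u g y t} → Basic u → Feasible u g → NonZeroV g → SpansEdge u g →
    InP y → y ≈ u ⊕ t · g → 0ℚ < t → (∀ t′ → t < t′ → ¬ InP (u ⊕ t′ · g)) → Basic y × IsEdge u y
  IsEdge-step {u} {g} {y} {t} basic (gK , gA) g≢0 spans yP y≈ t>0 blocked =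
    (yP , λ {h} → kernel-trivial {h}) , (face , has-two , not-three)
    where
    uP : InP u
    uP = proj₁ basic
    dot-y : ∀ c → dot c y ≡ dot c u + t * dot c g
    dot-y c = trans (dot-cong c y≈) (dot-step c u t g)
    T : Fin m → Set
    T j = Active u j × dot (B j) g ≡ 0ℚ
    T? : ∀ j → Dec (T j)
    T? j = active? u j ×-dec (dot (B j) g ≟ 0ℚ)
    T⇒active-y : ∀ j → T j → Active y j
    T⇒active-y j (uj , Bg≡0) = trans (dot-y (B j)) (trans (cong (λ z → dot (B j) u + t * z) Bg≡0)
      (trans (cong (dot (B j) u +_) (ℚP.*-zeroʳ t)) (trans (ℚP.+-identityʳ (dot (B j) u)) uj)))
    Blocking : Fin m → Set
    Blocking j = Active y j × 0ℚ < dot (B j) g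
    blocking : Σ (Fin m) Blocking
    blocking = by (FinP.any? λ j → active? y j ×-dec (0ℚ <? dot (B j) g))
      where
      by : Dec (Σ (Fin m) Blocking) → Σ (Fin m) Blocking
      by (yes j)   = j
      by (no none) = contradiction (beyond (small-step yP (gK , λ j yj → ≮⇒≥ λ pos → none (j , yj , pos)))) λ ()
        where
        grows : ∀ t s → t + s - t ≡ s
        grows = solve-∀ ℚ-ring
        regroup : ∀ u t g s → u + t * g + s * g ≡ u + (t + s) * g
        regroup = solve-∀ ℚ-ring
        beyond : (Σ ℚ λ s → 0ℚ < s × InP (y ⊕ s · g)) → ⊥
        beyond (s , s>0 , zP) = blocked (t + s) (<-by s s>0 (grows t s))
          (InP-resp (λ i → trans (cong (_+ s * g i) (y≈ i)) (regroup (u i) t (g i) s)) zP)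
    j₀ : Fin m
    j₀ = proj₁ blocking
    Bj₀g>0 : 0ℚ < dot (B j₀) g
    Bj₀g>0 = proj₂ (proj₂ blocking)
    i₀ : Fin m
    i₀ = proj₁ (leaving-row basic (gK , gA) g≢0)
    ui₀ : Active u i₀
    ui₀ = proj₁ (proj₂ (leaving-row basic (gK , gA) g≢0))
    Bi₀g<0 : dot (B i₀) g < 0ℚ
    Bi₀g<0 = proj₂ (proj₂ (leaving-row basic (gK , gA) g≢0))
    kernel-trivial : ∀ {h} → InKer h → (∀ j → Active y j → dot (B j) h ≡ 0ℚ) → h ≈ zeroV
    kernel-trivial {h} hK hA = vanish (spans hK λ j uj Bg≡0 → hA j (T⇒active-y j (uj , Bg≡0)))
      where
      vanish : (Σ ℚ λ s → h ≈ s · g) → h ≈ zeroV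
      vanish (s , h≈sg) c = trans (h≈sg c) (trans (cong (_* g c) s≡0) (ℚP.*-zeroˡ (g c)))
        where
        s≡0 : s ≡ 0ℚ
        s≡0 = *-cancel-0 (pos≢0 Bj₀g>0) (trans (ℚP.*-comm (dot (B j₀) g) s)
          (trans (sym (dot-· (B j₀) s g)) (trans (sym (dot-cong (B j₀) h≈sg)) (hA j₀ (proj₁ (proj₂ blocking))))))
    r : ℚ
    r = proj₁ (pos-inverse t>0)
    r>0 : 0ℚ < r
    r>0 = proj₁ (proj₂ (pos-inverse t>0))
    tr≡1 : t * r ≡ 1ℚ
    tr≡1 = proj₂ (proj₂ (pos-inverse t>0))
    difference : ∀ c → (y ⊖ u) c ≡ t * g c
    difference c = trans (cong (_+ - u c) (y≈ c)) (eqn (u c) (t * g c))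
      where
      eqn : ∀ u x → u + x + - u ≡ x
      eqn = solve-∀ ℚ-ring
    face : IsFace (Segment u y)
    face = IsFace-resp (to , from) (TightFace-isFace T?)
      where
      to : Segment u y ⊆ TightFace T
      to x (s , s≥0 , s≤1 , x≈) = InP-resp (λ c → sym (x≈ c)) (InP-step s uP (InKer-⊖ yP uP) below) , tight
        where
        below : ∀ j → s * dot (B j) (y ⊖ u) ≤ slack u j
        below j = ≤-by _ (+-nonneg (*-nonneg (p≤q⇒0≤q-p s≤1) (slack≥0 uP j)) (*-nonneg s≥0 (slack≥0 yP j)))
          (trans (cong (λ z → slack u j - s * z) (dot-⊖ (B j) y u)) (eqn (d j) (dot (B j) u) (dot (B j) y) s))
          where
          eqn : ∀ d u y s → (d - u) - s * (y - u) ≡ (1ℚ - s) * (d - u) + s * (d - y)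
          eqn = solve-∀ ℚ-ring
        tight : ∀ j → T j → Active x j
        tight j Tj = trans (dot-cong (B j) x≈) (trans (dot-step (B j) u s (y ⊖ u))
          (trans (cong (λ z → dot (B j) u + s * z) (trans (dot-⊖ (B j) y u)
            (cong₂ _-_ (T⇒active-y j Tj) (proj₁ Tj)))) (trans (cong (_+ s * (d j - d j)) (proj₁ Tj)) (eqn (d j) s))))
          where
          eqn : ∀ d s → d + s * (d - d) ≡ d
          eqn = solve-∀ ℚ-ring
      from : TightFace T ⊆ Segment u y
      from x (xP , tight) = on-line (spans (InKer-⊖ xP uP) λ j uj Bg≡0 → trans (dot-⊖ (B j) x u)
        (trans (cong₂ _-_ (tight j (uj , Bg≡0)) uj) (ℚP.+-inverseʳ (d j))))
        where
        on-line : (Σ ℚ λ s → x ⊖ u ≈ s · g) → Segment u y x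
        on-line (s , x-u≈) = s * r , *-nonneg s≥0 (<⇒≤ r>0) , sr≤1 , x≈
          where
          dot-x : ∀ c → dot c x - dot c u ≡ s * dot c g
          dot-x c = trans (sym (dot-⊖ c x u)) (trans (dot-cong c x-u≈) (dot-· c s g))
          s≥0 : 0ℚ ≤ s
          s≥0 = *-cancel-nonneg (p<0⇒0<-p Bi₀g<0) (subst (0ℚ ≤_) (trans (eqn (d i₀) (dot (B i₀) x))
            (trans (cong -_ (trans (cong (λ z → dot (B i₀) x - z) (sym ui₀)) (dot-x (B i₀))))
              (eqn′ s (dot (B i₀) g)))) (slack≥0 xP i₀))
            where
            eqn : ∀ d x → d - x ≡ - (x - d)
            eqn = solve-∀ ℚ-ring
            eqn′ : ∀ s g → - (s * g) ≡ - g * s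
            eqn′ = solve-∀ ℚ-ring
          t-s≥0 : 0ℚ ≤ t - s
          t-s≥0 = *-cancel-nonneg Bj₀g>0 (subst (0ℚ ≤_) (trans
            (cong (_- dot (B j₀) x) (trans (sym (proj₁ (proj₂ blocking))) (dot-y (B j₀))))
            (trans (eqn (dot (B j₀) u) (t * dot (B j₀) g) (dot (B j₀) x))
              (trans (cong (λ z → t * dot (B j₀) g - z) (dot-x (B j₀))) (eqn′ t s (dot (B j₀) g)))))
            (slack≥0 xP j₀))
            where
            eqn : ∀ u a x → (u + a) - x ≡ a - (x - u)
            eqn = solve-∀ ℚ-ring
            eqn′ : ∀ t s g → t * g - s * g ≡ g * (t - s)
            eqn′ = solve-∀ ℚ-ring
          sr≤1 : s * r ≤ 1ℚ
          sr≤1 = ≤-by _ (*-nonneg t-s≥0 (<⇒≤ r>0)) (trans (cong (_- s * r) (sym tr≡1)) (eqn t s r))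
            where
            eqn : ∀ t s r → t * r - s * r ≡ (t - s) * r
            eqn = solve-∀ ℚ-ring
          x≈ : x ≈ u ⊕ (s * r) · (y ⊖ u)
          x≈ c = trans (eqn (x c) (u c)) (cong (u c +_) (trans (x-u≈ c)
            (trans (sym (ℚP.*-identityʳ (s * g c))) (trans (cong (s * g c *_) (sym tr≡1))
              (trans (eqn′ s (g c) t r) (cong (s * r *_) (sym (difference c))))))))
            where
            eqn : ∀ x u → x ≡ u + (x - u)
            eqn = solve-∀ ℚ-ring
            eqn′ : ∀ s g t r → s * g * (t * r) ≡ s * r * (t * g)
            eqn′ = solve-∀ ℚ-ring
    c₀ : Fin n
    c₀ = proj₁ g≢0
    y-u≢0 : (y ⊖ u) c₀ ≢ 0ℚ
    y-u≢0 e = proj₂ g≢0 (*-cancel-0 (pos≢0 t>0) (trans (sym (difference c₀)) e))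
    has-two : HasAffIndep (Segment u y) 2
    has-two = u , (λ _ → y) ,
      (0ℚ , ≤-refl , <⇒≤ 0<1 , λ c → eqn (u c) (y c)) ,
      (λ _ → 1ℚ , <⇒≤ 0<1 , ≤-refl , λ c → eqn′ (u c) (y c)) ,
      λ { l e zero → *-cancel-0 y-u≢0 (trans (eqn″ (l zero) ((y ⊖ u) c₀)) (e c₀)) }
      where
      eqn : ∀ u y → u ≡ u + 0ℚ * (y - u)
      eqn = solve-∀ ℚ-ring
      eqn′ : ∀ u y → y ≡ u + 1ℚ * (y - u)
      eqn′ = solve-∀ ℚ-ring
      eqn″ : ∀ l x → x * l ≡ l * x + 0ℚ
      eqn″ = solve-∀ ℚ-ring
    not-three : ¬ HasAffIndep (Segment u y) 3
    not-three (p₀ , p , (s₀ , _ , _ , p₀≈) , pS , indep) = ℚP.1≢0 (indep (λ { zero → 1ℚ ; (suc _) → 0ℚ })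
      (λ c → trans (eqn₁ ((p zero ⊖ p₀) c) ((p (suc zero) ⊖ p₀) c))
        (trans (offset zero c) (trans (cong (_* (y ⊖ u) c) s₁-s₀≡0) (ℚP.*-zeroˡ ((y ⊖ u) c))))) zero)
      where
      s : Fin 2 → ℚ
      s a = proj₁ (pS a)
      offset : ∀ a c → (p a ⊖ p₀) c ≡ (s a - s₀) * (y ⊖ u) c
      offset a c = trans (cong₂ _-_ (proj₂ (proj₂ (proj₂ (pS a))) c) (p₀≈ c)) (eqn (u c) (s a) s₀ ((y ⊖ u) c))
        where
        eqn : ∀ u s s₀ x → u + s * x - (u + s₀ * x) ≡ (s - s₀) * x
        eqn = solve-∀ ℚ-ring
      eqn₁ : ∀ a b → 1ℚ * a + (0ℚ * b + 0ℚ) ≡ a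
      eqn₁ = solve-∀ ℚ-ring
      -- Both differences from `p₀` are multiples of `y ⊖ u`, and these coefficients cancel them.
      -- Independence then makes the first difference zero, which the coefficients 1 and 0
      -- contradict.
      cross : Fin 2 → ℚ
      cross zero    = s (suc zero) - s₀
      cross (suc _) = - (s zero - s₀)
      eqn₂ : ∀ a b x → b * (a * x) + (- a * (b * x) + 0ℚ) ≡ 0ℚ
      eqn₂ = solve-∀ ℚ-ring
      s₁-s₀≡0 : s zero - s₀ ≡ 0ℚ
      s₁-s₀≡0 = trans (sym (neg-neg (s zero - s₀))) (cong -_ (indep cross
        (λ c → trans (cong₂ (λ a b → cross zero * a + (cross (suc zero) * b + 0ℚ)) (offset zero c) (offset (suc zero) c))
          (eqn₂ (s zero - s₀) (s (suc zero) - s₀) ((y ⊖ u) c))) (suc zero)))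
        where
        neg-neg : ∀ a → - (- a) ≡ a
        neg-neg = solve-∀ ℚ-ring

  -- The minimal face of two vertices

  Common : Vecℚ n → Vecℚ n → Fin m → Set
  Common u v j = Active u j × Active v j

  common? : ∀ u v j → Dec (Common u v j)
  common? u v j = active? u j ×-dec active? v j

  -- At the midpoint of `u` and `v` only the common rows are active, and it lies in `G`. So the
  -- functional of `G` vanishes on every direction from it on which the common rows do.
  TightFace-⊆ : ∀ {G u v} → IsFace G → G u → G v → TightFace (Common u v) ⊆ G
  TightFace-⊆ {G} {u} {v} (c , δ , valid , G⊆ , ⊆G) Gu Gv x (xP , tight) = ⊆G x (xP , cx≡δ)
    where
    uF : FaceSet c δ u
    uF = G⊆ u Gu
    vF : FaceSet c δ v
    vF = G⊆ v Gv
    w : Vecℚ n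
    w = u ⊕ ½ · (v ⊖ u)
    eqn : ∀ d u v → (d - u) - ½ * (v - u) ≡ ½ * ((d - u) + (d - v))
    eqn = solve-∀ ℚ-ring
    slack-w : ∀ j → slack w j ≡ ½ * (slack u j + slack v j)
    slack-w j = trans (slack-step u ½ (v ⊖ u) j) (trans (cong (λ z → slack u j - ½ * z) (dot-⊖ (B j) v u))
      (eqn (d j) (dot (B j) u) (dot (B j) v)))
    wP : InP w
    wP = InP-step ½ (proj₁ uF) (InKer-⊖ (proj₁ vF) (proj₁ uF)) λ j → 0≤q-p⇒p≤q
      (subst (0ℚ ≤_) (trans (sym (slack-w j)) (slack-step u ½ (v ⊖ u) j))
        (*-nonneg (<⇒≤ 0<½) (+-nonneg (slack≥0 (proj₁ uF) j) (slack≥0 (proj₁ vF) j))))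
    +-cancel-0 : ∀ {a c} → 0ℚ ≤ a → 0ℚ ≤ c → a + c ≡ 0ℚ → a ≡ 0ℚ
    +-cancel-0 {a} {c} 0≤a 0≤c a+c≡0 = ≤-antisym (≤-by c 0≤c (trans (cong (_- a) (sym a+c≡0)) (drop a c))) 0≤a
      where
      drop : ∀ a c → a + c - a ≡ c
      drop = solve-∀ ℚ-ring
    common : ∀ j → Active w j → Common u v j
    common j wj =
      slack≡0⇒active u j (+-cancel-0 (slack≥0 (proj₁ uF) j) (slack≥0 (proj₁ vF) j) both) ,
      slack≡0⇒active v j (+-cancel-0 (slack≥0 (proj₁ vF) j) (slack≥0 (proj₁ uF) j)
        (trans (ℚP.+-comm (slack v j) (slack u j)) both))
      where
      both : slack u j + slack v j ≡ 0ℚ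
      both = *-cancel-0 (pos≢0 0<½) (trans (sym (slack-w j)) (active⇒slack≡0 w j wj))
    cw≡δ : dot c w ≡ δ
    cw≡δ = trans (dot-step c u ½ (v ⊖ u)) (trans (cong₂ (λ a z → a + ½ * z) (proj₂ uF)
      (trans (dot-⊖ c v u) (cong₂ _-_ (proj₂ vF) (proj₂ uF)))) (eqn′ δ))
      where
      eqn′ : ∀ δ → δ + ½ * (δ - δ) ≡ δ
      eqn′ = solve-∀ ℚ-ring
    c-normal : dot c (x ⊖ w) ≡ 0ℚ
    c-normal = FaceSet-normal {c} {δ} valid (wP , cw≡δ) (InKer-⊖ xP wP) λ j wj →
      trans (dot-⊖ (B j) x w) (trans (cong₂ _-_ (tight j (common j wj)) wj) (ℚP.+-inverseʳ (d j)))
    cx≡δ : dot c x ≡ δ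
    cx≡δ = trans (sym (add (dot c x) (dot c w))) (trans (cong (_+ dot c w) (trans (sym (dot-⊖ c x w)) c-normal))
      (trans (ℚP.+-identityˡ (dot c w)) cw≡δ))
      where
      add : ∀ x w → x - w + w ≡ x
      add = solve-∀ ℚ-ring

  -- Vectors are functions and `F` is an arbitrary predicate; its description as a face makes it
  -- respect pointwise equality.
  IsFace-≈ : ∀ {F x y} → IsFace F → x ≈ y → F x → F y
  IsFace-≈ (c , δ , _ , F⊆ , ⊆F) x≈y Fx = ⊆F _ (InP-resp x≈y (proj₁ (F⊆ _ Fx)) ,
    trans (sym (dot-cong c x≈y)) (proj₂ (F⊆ _ Fx)))

  Common-IsMinFace : ∀ {u v} → InP u → InP v → IsMinFace (TightFace (Common u v)) u v
  Common-IsMinFace {u} {v} uP vP = TightFace-isFace (common? u v) ,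
    (uP , λ j → proj₁) , (vP , λ j → proj₂) , λ G Gface Gu Gv → TightFace-⊆ Gface Gu Gv

  InnerCone-resp : ∀ {F G w} → F ⊆ G → InnerCone F w ⊆ InnerCone G w
  InnerCone-resp F⊆G g (ε , ε>0 , Fx) = ε , ε>0 , F⊆G _ Fx

  Common-InnerCone : ∀ {u v h} → InP u → Feasible u h →
    (∀ j → Common u v j → dot (B j) h ≡ 0ℚ) → InnerCone (TightFace (Common u v)) u h
  Common-InnerCone {u} {v} {h} uP hF hC = on-face (small-step uP hF)
    where
    on-face : (Σ ℚ λ t → 0ℚ < t × InP (u ⊕ t · h)) → InnerCone (TightFace (Common u v)) u h
    on-face (t , t>0 , yP) = t , t>0 , yP , λ j uvj → trans (dot-step (B j) u t h)
      (trans (cong₂ (λ a z → a + t * z) (proj₁ uvj) (hC j uvj))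
        (trans (cong (d j +_) (ℚP.*-zeroʳ t)) (ℚP.+-identityʳ (d j))))

  module _ (bounded : Bounded) (minimal : MinimalRep) (simple : Simple) where

    -- From inner cones to edge walks

    module FromCones (cones : InnerConeCondition) where

      -- An edge at u cannot approach a row that is not active at u with the wrong sign: the facet of that row
      -- has a vertex off the facet the edge leaves, and the edge is then in the inner cone towards it.
      edge-nonneg : ∀ {u i j e} → Basic u → Active u i → ¬ Active u j →
        EdgeAt u i e → Feasible u e → 0ℚ ≤ dot (B j) e
      edge-nonneg {u} {i} {j} {e} basic ui ¬uj edge eF = ≤-stable (
        positive-rank minimal i (proj₁ basic) ui >>= λ rank →
        at-point (Dimension.separating-point minimal (proj₂ rank) i j (proj₁ basic) ui ¬uj))
        where
        at-vertex : ∀ {x} → IneqFace j x → dot (B i) x < d i → VertexBelow (B i) x → 0ℚ ≤ dot (B j) e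
        at-vertex {x} xF Bix<dᵢ (v , v-basic , v⊇x , Biv≤Bix , _) = -p≤0⇒0≤p
          (subst (_≤ 0ℚ) (dot-neg (B j) e) (opposite (Equivalence.to
            (cones u v (Basic⇒IsVertex basic) (Basic⇒IsVertex v-basic) (TightFace (Common u v))
              (Common-IsMinFace (proj₁ basic) (proj₁ v-basic)) e)
            (Common-InnerCone (proj₁ basic) eF e-common))))
          where
          opposite : InnerCone (TightFace (Common u v)) v (neg e) → dot (B j) (neg e) ≤ 0ℚ
          opposite (t , t>0 , yF) = feasible-active {v} {neg e} {t} t>0 (proj₁ yF) j (v⊇x j (proj₂ xF))
          off : dot (B i) (v ⊖ u) ≢ 0ℚ
          off e = <⇒≢ (≤-<-trans Biv≤Bix Bix<dᵢ) (trans (sym (add (dot (B i) v) (dot (B i) u)))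
            (trans (cong (_+ dot (B i) u) (trans (sym (dot-⊖ (B i) v u)) e))
              (trans (ℚP.+-identityˡ (dot (B i) u)) ui)))
            where
            add : ∀ x w → x - w + w ≡ x
            add = solve-∀ ℚ-ring
          -- A common row that changes along `e` would determine row `i` and force it to vanish on
          -- `v ⊖ u`, but `v` is off facet `i`.
          e-common : ∀ r → Common u v r → dot (B r) e ≡ 0ℚ
          e-common r (ur , vr) = ≡-stable λ Be≢0 → off (Determines-leaving edge r ur Be≢0
            (InKer-⊖ (proj₁ v-basic) (proj₁ basic))
            (trans (dot-⊖ (B r) v u) (trans (cong₂ _-_ vr ur) (ℚP.+-inverseʳ (d r)))))
        at-point : (Σ (Vecℚ n) λ x → IneqFace j x × dot (B i) x < d i) → ¬ ¬ (0ℚ ≤ dot (B j) e)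
        -- Walking without increase of row `i` ends at a vertex still off facet `i`, and row `j`
        -- remains active on the way.
        at-point (x , xF , Bix<dᵢ) = walk-to-vertex bounded (B i) (proj₁ xF) >>= λ below →
          return (at-vertex xF Bix<dᵢ below)

      feasible-nonneg : ∀ {u j h} → Basic u → ¬ Active u j → Feasible u h → 0ℚ ≤ dot (B j) h
      feasible-nonneg {u} {j} basic ¬uj hF = cone-nonneg minimal simple basic j hF
        λ i ui _ e edge eF → edge-nonneg basic ui ¬uj edge eF

      -- Stripping the edge direction off `g` gives a vector supported within the support of `g` but
      -- not on row `i`. Minimality makes it zero, so `g` is parallel to `e`; so is `h`, whose
      -- stripped part vanishes on all active rows.
      circuit-SpansEdge : ∀ {u} {g : Fin n → ℤ} → Basic u → IsCircuit g → Feasible u (toℚ g) → SpansEdge u (toℚ g)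
      circuit-SpansEdge {u} {g} basic (gK , g≢0 , _ , min) gF =
        SpansEdge-stable basic gF g≢0 (edge-exists′ minimal simple basic ui >>= λ edge → return (λ {h} → spans edge {h}))
        where
        i : Fin m
        i = proj₁ (leaving-row basic gF g≢0)
        ui : Active u i
        ui = proj₁ (proj₂ (leaving-row basic gF g≢0))
        Big<0 : dot (B i) (toℚ g) < 0ℚ
        Big<0 = proj₂ (proj₂ (leaving-row basic gF g≢0))
        q : ℚ
        q = proj₁ (inverse (<⇒≢ Big<0))
        spans : (Σ (Vecℚ n) λ e → EdgeAt u i e × Feasible u e) → SpansEdge u (toℚ g)
        spans (e , edge , eF) {h} hK hA = dot (B i) h * q , λ c → combine (h c) (toℚ g c) (e c)
            (dot (B i) h) (dot (B i) (toℚ g)) q (strip-h≈0 c) (strip-g≈0 c) (proj₂ (inverse (<⇒≢ Big<0)))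
          where
          g′ : Vecℚ n
          g′ = strip edge (toℚ g)
          -- Row `j` is nonnegative both on `g′` and on the part of `g` along `e`, and the two
          -- values add up to zero.
          inactive-0 : ∀ j → ¬ Active u j → dot (B j) (toℚ g) ≡ 0ℚ → dot (B j) g′ ≡ 0ℚ
          inactive-0 j ¬uj Bjg≡0 = ≤-antisym
            (subst (_≤ 0ℚ) (sym (dot-strip edge (B j) (toℚ g))) (≤-by _
              (*-nonneg (<⇒≤ (p<0⇒0<-p Big<0)) (edge-nonneg basic ui ¬uj edge eF))
              (trans (cong (λ z → 0ℚ - (z + dot (B i) (toℚ g) * dot (B j) e)) Bjg≡0)
                (eqn (dot (B i) (toℚ g)) (dot (B j) e)))))
            (feasible-nonneg basic ¬uj (strip-feasible edge gF))
            where
            eqn : ∀ a e → 0ℚ - (0ℚ + a * e) ≡ - a * e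
            eqn = solve-∀ ℚ-ring
          kept-0 : ∀ j → dot (B j) (toℚ g) ≡ 0ℚ → Dec (Active u j) → dot (B j) g′ ≡ 0ℚ
          kept-0 j Bjg≡0 (no ¬uj) = inactive-0 j ¬uj Bjg≡0
          kept-0 j Bjg≡0 (yes uj) = [ (λ eq → trans eq Bjg≡0) , (λ eq → eq) ]′ (strip-active edge gK j uj)
          strip-g≈0 : g′ ≈ zeroV
          strip-g≈0 = [ (λ z → z) , (λ g′≢0 → contradiction (strip-leaving edge (toℚ g))
              (min g′ (strip-InKer edge gK) g′≢0 (λ j g′j Bjg≡0 → g′j (kept-0 j Bjg≡0 (active? u j)))
                i (<⇒≢ Big<0))) ]′ (≈0-or-NonZeroV g′)
          strip-h-active : ∀ j → Active u j → dot (B j) (strip edge h) ≡ 0ℚ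
          strip-h-active j uj = [ parallel , (λ det → det (strip-InKer edge hK) (strip-leaving edge h)) ]′
              (proj₂ (proj₂ edge) j uj)
            where
            eqn : ∀ g a → g ≡ (g + a * 0ℚ)
            eqn = solve-∀ ℚ-ring
            parallel : dot (B j) e ≡ 0ℚ → dot (B j) (strip edge h) ≡ 0ℚ
            parallel Bje≡0 = trans (dot-strip edge (B j) h) (trans (cong (λ z → dot (B j) h + dot (B i) h * z) Bje≡0)
              (trans (sym (eqn (dot (B j) h) (dot (B i) h))) (hA j uj (trans (eqn (dot (B j) (toℚ g)) (dot (B i) (toℚ g)))
                (trans (cong (λ z → dot (B j) (toℚ g) + dot (B i) (toℚ g) * z) (sym Bje≡0))
                  (trans (sym (dot-strip edge (B j) (toℚ g))) (dot-zeroV (B j) strip-g≈0)))))))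
          strip-h≈0 : strip edge h ≈ zeroV
          strip-h≈0 = proj₂ basic (strip-InKer edge hK) strip-h-active
          combine : ∀ h g e a c q → h + a * e ≡ 0ℚ → g + c * e ≡ 0ℚ → c * q ≡ 1ℚ → h ≡ a * q * g
          combine h g e a c q hae gce cq = trans (eqn h a e) (trans (cong (λ z → z - a * (1ℚ * e)) hae)
            (trans (cong (λ z → 0ℚ - a * (z * e)) (sym cq)) (trans (eqn′ a c q e g)
              (trans (cong (λ z → a * q * g - a * q * z) gce) (eqn″ (a * q) g)))))
            where
            eqn : ∀ h a e → h ≡ h + a * e - a * (1ℚ * e)
            eqn = solve-∀ ℚ-ring
            eqn′ : ∀ a c q e g → 0ℚ - a * (c * q * e) ≡ a * q * g - a * q * (g + c * e)
            eqn′ = solve-∀ ℚ-ring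
            eqn″ : ∀ x g → x * g - x * 0ℚ ≡ x * g
            eqn″ = solve-∀ ℚ-ring

      walk-is-edge-walk : ∀ k {v₁ v₂} y → Basic v₁ → IsCircuitWalk v₁ v₂ k y → IsEdgeWalk k y
      walk-is-edge-walk zero y basic (start , _) =
        (λ { zero → Basic⇒IsVertex (Basic-resp (λ c → sym (start c)) basic) }) , λ ()
      walk-is-edge-walk (suc k) {v₁} {v₂} y basic (start , end , inside , steps) = first (steps zero)
        where
        y₀-basic : Basic (y zero)
        y₀-basic = Basic-resp (λ c → sym (start c)) basic
        first : (Σ (Fin n → ℤ) λ g → Σ ℚ λ α → IsCircuit g × 0ℚ < α × y (suc zero) ≈ y zero ⊕ α · toℚ g ×
          (∀ α′ → α < α′ → ¬ InP (y zero ⊕ α′ · toℚ g))) → IsEdgeWalk (suc k) y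
        first (g , α , circ , α>0 , y₁≈ , blocked) =
          (λ { zero → Basic⇒IsVertex y₀-basic ; (suc i) → proj₁ rest i }) ,
          λ { zero → proj₂ edge ; (suc i) → proj₂ rest i }
          where
          gF : Feasible (y zero) (toℚ g)
          gF = proj₁ circ , feasible-active {y zero} {toℚ g} {α} α>0 (InP-resp y₁≈ (inside (suc zero)))
          edge : Basic (y (suc zero)) × IsEdge (y zero) (y (suc zero))
          edge = IsEdge-step {y zero} {toℚ g} {y (suc zero)} {α} y₀-basic gF (proj₁ (proj₂ circ))
            (circuit-SpansEdge {g = g} y₀-basic circ gF) (inside (suc zero)) y₁≈ α>0 blocked
          rest : IsEdgeWalk k (y ∘ suc)
          rest = walk-is-edge-walk k {y (suc zero)} {v₂} (y ∘ suc) (proj₁ edge)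
            ((λ _ → refl) , end , inside ∘ suc , steps ∘ suc)

    -- From edge walks to inner cones

    module FromWalks (walks : AllCircuitWalksAreEdgeWalks) where

      -- The first step of a walk from u along g is an edge, because the walk can be continued to a vertex.
      feasible-circuit-SpansEdge : ∀ {u} {g : Fin n → ℤ} → Basic u → IsCircuit g → Feasible u (toℚ g) →
        ¬ ¬ SpansEdge u (toℚ g)
      feasible-circuit-SpansEdge {u} {g} basic circ gF = along (max-step bounded (proj₁ basic) (proj₁ (proj₂ circ)) gF)
        where
        module Along (t : ℚ) (t>0 : 0ℚ < t) (yP : InP (u ⊕ t · toℚ g)) (j : Fin m)
          (pos : 0ℚ < dot (B j) (toℚ g)) (act : Active (u ⊕ t · toℚ g) j) where
          γ : Vecℚ n
          γ = toℚ g
          uP : InP u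
          uP = proj₁ basic
          first-edge : VertexBelow zeroV (u ⊕ t · γ) → Σ (Vecℚ n) λ y → y ≈ u ⊕ t · γ × IsEdge u y
          first-edge (v , v-basic , _ , _ , k , ys , walk) = ys zero , proj₁ walk ,
            proj₂ (walks u v (Basic⇒IsVertex basic) (Basic⇒IsVertex v-basic) (suc k) (prepend u ys)
              (walk-prepend {u} {v} {k} {ys} {g} {t} uP circ t>0 (beyond-blocked {u} {γ} {t} j pos act) walk)) zero
          -- At the midpoint of the first step only rows active at `u` and constant along `γ` are
          -- active. From there `h` can be followed without leaving the segment, which yields its
          -- coefficient.
          w : Vecℚ n
          w = u ⊕ (½ * t) · γ
          half-row : ∀ i → Active w i → Active u i × dot (B i) γ ≡ 0ℚ
          half-row i wi = slack≡0⇒active u i su≡0 , *-cancel-0 {½ * t} (pos≢0 (*-pos 0<½ t>0))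
              (trans (eqn (slack u i) ((½ * t) * dot (B i) γ)) (trans (cong₂ _-_ su≡0 sw≡0) refl))
            where
            sw≡0 : slack u i - (½ * t) * dot (B i) γ ≡ 0ℚ
            sw≡0 = trans (sym (slack-step u (½ * t) γ i)) (active⇒slack≡0 w i wi)
            sy≥0 : 0ℚ ≤ slack u i - t * dot (B i) γ
            sy≥0 = subst (0ℚ ≤_) (slack-step u t γ i) (slack≥0 yP i)
            eqn : ∀ s x → x ≡ s - (s - x)
            eqn = solve-∀ ℚ-ring
            eqn′ : ∀ s t x → 0ℚ - s ≡ (s - t * x) - (1ℚ + 1ℚ) * (s - (½ * t) * x)
            eqn′ = solve-∀ ℚ-ring
            eqn″ : ∀ y → y - (1ℚ + 1ℚ) * 0ℚ ≡ y
            eqn″ = solve-∀ ℚ-ring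
            su≡0 : slack u i ≡ 0ℚ
            su≡0 = ≤-antisym (≤-by _ sy≥0 (trans (eqn′ (slack u i) t (dot (B i) γ))
              (trans (cong (λ z → (slack u i - t * dot (B i) γ) - (1ℚ + 1ℚ) * z) sw≡0)
                (eqn″ (slack u i - t * dot (B i) γ))))) (slack≥0 uP i)
          spans : (Σ (Vecℚ n) λ y → y ≈ u ⊕ t · γ × IsEdge u y) → SpansEdge u γ
          spans (y , y≈ , (c , δ , valid , S⊆ , ⊆S) , _) {h} hK hA =
            onto (small-step (proj₁ wF) (hK , λ i wi → ≤-reflexive (h-tight i wi)))
            where
            eqn : ∀ u t g → u + ½ * t * g ≡ u + ½ * (u + t * g - u)
            eqn = solve-∀ ℚ-ring
            wF : FaceSet c δ w
            wF = S⊆ w (½ , <⇒≤ 0<½ , ≤-by ½ (<⇒≤ 0<½) refl , λ c →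
              trans (eqn (u c) t (γ c)) (cong (λ z → u c + ½ * (z - u c)) (sym (y≈ c))))
            h-tight : ∀ i → Active w i → dot (B i) h ≡ 0ℚ
            h-tight i wi = hA i (proj₁ (half-row i wi)) (proj₂ (half-row i wi))
            onto : (Σ ℚ λ s → 0ℚ < s × InP (w ⊕ s · h)) → Σ ℚ λ s → h ≈ s · γ
            onto (s , s>0 , zP) = read (⊆S (w ⊕ s · h) (zP , trans (dot-step c w s h)
              (trans (cong₂ (λ a z → a + s * z) (proj₂ wF) (FaceSet-normal {c} {δ} valid wF hK h-tight))
                (trans (cong (δ +_) (ℚP.*-zeroʳ s)) (ℚP.+-identityʳ δ)))))
              where
              q : ℚ
              q = proj₁ (pos-inverse s>0)
              read : Segment u y (w ⊕ s · h) → Σ ℚ λ s → h ≈ s · γ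
              read (r , _ , _ , z≈) = q * (r * t - ½ * t) , λ c →
                solve-for (u c) t (γ c) s q r (h c) (proj₂ (proj₂ (pos-inverse s>0)))
                  (trans (z≈ c) (cong (λ z → u c + r * (z - u c)) (y≈ c)))
                where
                solve-for : ∀ u t g s q r h → s * q ≡ 1ℚ →
                  u + ½ * t * g + s * h ≡ u + r * (u + t * g - u) → h ≡ q * (r * t - ½ * t) * g
                solve-for u t g s q r h sq e = trans (sym (ℚP.*-identityˡ h)) (trans (cong (_* h) (sym sq))
                  (trans (eqn₁ u t g s q h) (trans (cong (λ z → q * (z - u - ½ * t * g)) e) (eqn₂ u t g q r))))
                  where
                  eqn₁ : ∀ u t g s q h → s * q * h ≡ q * (u + ½ * t * g + s * h - u - ½ * t * g)
                  eqn₁ = solve-∀ ℚ-ring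
                  eqn₂ : ∀ u t g q r → q * (u + r * (u + t * g - u) - u - ½ * t * g) ≡ q * (r * t - ½ * t) * g
                  eqn₂ = solve-∀ ℚ-ring
        along : (Σ ℚ λ t → 0ℚ < t × InP (u ⊕ t · toℚ g) ×
          Σ (Fin m) λ j → 0ℚ < dot (B j) (toℚ g) × Active (u ⊕ t · toℚ g) j) → ¬ ¬ SpansEdge u (toℚ g)
        -- Any vertex will do as the end of the walk, hence the zero functional.
        along (t , t>0 , yP , j , pos , act) = walk-to-vertex bounded zeroV yP >>= λ below →
          return (λ {h} → spans (first-edge below) {h})
          where open Along t t>0 yP j pos act

      -- Circuits in a cone of feasible directions

      module _ {u : Vecℚ n} (i j : Fin m) where

        Towards : Vecℚ n → Set
        Towards x = InKer x × dot (B i) x < 0ℚ × (∀ r → Active u r → dot (B r) x ≤ 0ℚ) × 0ℚ ≤ dot (B j) x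

        MinimalTowards : Vecℚ n → Set
        MinimalTowards x = Towards x ×
          ∀ {y} → Towards y → (∀ r → Supp y r → Supp x r) → ∀ r → Supp x r → Supp y r

        -- x is moved along - h until some row in its support vanishes; no row changes sign on the way.
        Reduced : Vecℚ n → Vecℚ n → Set
        Reduced x h = Σ ℚ λ t → let x′ = x ⊕ (- t) · h in
          (∀ r → 0ℚ ≤ dot (B r) x → 0ℚ ≤ dot (B r) x′) × (∀ r → dot (B r) x ≤ 0ℚ → dot (B r) x′ ≤ 0ℚ) ×
          (∀ r → Supp x′ r → Supp x r) × Σ (Fin m) λ r → Supp x r × ¬ Supp x′ r

        -- The ratio test is applied to the products of row values with those of `x`: comparing them
        -- with the squares treats rows of both signs at once, and equality marks the first row to
        -- vanish.
        reduce : ∀ {x h} → (∀ r → Supp h r → Supp x r) →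
          ∀ r → 0ℚ < dot (B r) h * dot (B r) x → Reduced x h
        reduce {x} {h} h⊆x r₀ aligned =
          by (max-ratio (λ r → dot (B r) h * dot (B r) x) (λ r → dot (B r) x * dot (B r) x)
            (λ r → *-square-nonneg (dot (B r) x)))
          where
          Bx Bh : Fin m → ℚ
          Bx r = dot (B r) x
          Bh r = dot (B r) h
          by : ((∀ r → Bh r * Bx r ≤ 0ℚ) ⊎
            Σ ℚ λ t → 0ℚ ≤ t × (∀ r → t * (Bh r * Bx r) ≤ Bx r * Bx r) ×
              Σ (Fin m) λ r → 0ℚ < Bh r * Bx r × t * (Bh r * Bx r) ≡ Bx r * Bx r) → Reduced x h
          by (inj₁ none) = contradiction (<-≤-trans aligned (none r₀)) (<-irrefl refl)
          by (inj₂ (t , _ , below , r₁ , pos , hit)) = t ,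
            (λ r → keep≥ (Bx r) (Bx′ r) (product≥0 r) (zero-stays r)) ,
            (λ r → keep≤ (Bx r) (Bx′ r) (product≥0 r) (zero-stays r)) ,
            (λ r x′r xr≡0 → x′r (zero-stays r xr≡0)) , r₁ , Bx₁≢0 , λ x′r → x′r (*-cancel-0 Bx₁≢0
              (trans (product r₁) (trans (cong (λ z → Bx r₁ * Bx r₁ - z) hit) (ℚP.+-inverseʳ (Bx r₁ * Bx r₁)))))
            where
            Bx′ : Fin m → ℚ
            Bx′ r = dot (B r) (x ⊕ (- t) · h)
            eqn : ∀ x t h → x * (x + - t * h) ≡ x * x - t * (h * x)
            eqn = solve-∀ ℚ-ring
            product : ∀ r → Bx r * Bx′ r ≡ Bx r * Bx r - t * (Bh r * Bx r)
            product r = trans (cong (Bx r *_) (dot-step (B r) x (- t) h)) (eqn (Bx r) t (Bh r))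
            product≥0 : ∀ r → 0ℚ ≤ Bx r * Bx′ r
            product≥0 r = subst (0ℚ ≤_) (sym (product r)) (p≤q⇒0≤q-p (below r))
            zero-stays : ∀ r → Bx r ≡ 0ℚ → Bx′ r ≡ 0ℚ
            zero-stays r xr≡0 = trans (dot-step (B r) x (- t) h) (trans (cong₂ (λ a z → a + - t * z) xr≡0
              (¬Supp⇒≡0 {h} r λ hr → h⊆x r hr xr≡0)) (trans (ℚP.+-identityˡ (- t * 0ℚ)) (ℚP.*-zeroʳ (- t))))
            Bx₁≢0 : Bx r₁ ≢ 0ℚ
            Bx₁≢0 e = <⇒≢ pos (sym (trans (cong (Bh r₁ *_) e) (ℚP.*-zeroʳ (Bh r₁))))

        -- `h` will be `y` or `neg y`, whichever agrees in sign with `x` in row `r`; apart from that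
        -- only its zero rows matter.
        Oriented : Vecℚ n → Vecℚ n → Fin m → Set
        Oriented x y r = Σ (Vecℚ n) λ h → InKer h × 0ℚ < dot (B r) h * dot (B r) x ×
          ∀ r′ → dot (B r′) y ≡ 0ℚ → dot (B r′) h ≡ 0ℚ

        orient : ∀ {x y} r → InKer y → Supp y r → Supp x r → Oriented x y r
        orient {x} {y} r yK yr xr = by (≢0⇒>0⊎<0 (λ e → xr (*-cancel-0 yr e)))
          where
          neg-out : ∀ a b → - (a * b) ≡ - a * b
          neg-out = solve-∀ ℚ-ring
          by : 0ℚ < dot (B r) y * dot (B r) x ⊎ dot (B r) y * dot (B r) x < 0ℚ → Oriented x y r
          by (inj₁ pos) = y , yK , pos , λ r′ e → e
          by (inj₂ yx<0) = neg y , InKer-neg yK ,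
            subst (0ℚ <_) (trans (neg-out (dot (B r) y) (dot (B r) x)) (cong (_* dot (B r) x) (sym (dot-neg (B r) y))))
              (p<0⇒0<-p yx<0) ,
            λ r′ e → trans (dot-neg (B r′) y) (cong -_ e)

        module _ {x : Vecℚ n} (xM : MinimalTowards x) where

          private
            xK : InKer x
            xK = proj₁ (proj₁ xM)
            Bix<0 : dot (B i) x < 0ℚ
            Bix<0 = proj₁ (proj₂ (proj₁ xM))
            reduced : Vecℚ n → ℚ → Vecℚ n
            reduced h t = x ⊕ (- t) · h

          -- A reduced direction stays in the cone unless row i is the one that vanishes.
          no-reduction : ∀ {h} → InKer h → ((t , _) : Reduced x h) → ¬ (dot (B i) (reduced h t) < 0ℚ)
          no-reduction hK (t , keep≥ , keep≤ , ⊆x , r , xr , ¬x′r) Bix′<0 = ¬x′r (proj₂ xM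
            (InKer-step (- t) xK hK , Bix′<0 , (λ r′ ur′ → keep≤ r′ (proj₁ (proj₂ (proj₂ (proj₁ xM))) r′ ur′)) ,
              keep≥ j (proj₂ (proj₂ (proj₂ (proj₁ xM))))) ⊆x r xr)

          dot-reduced : ∀ r h t → dot (B r) h ≡ 0ℚ → dot (B r) (reduced h t) ≡ dot (B r) x
          dot-reduced r h t Brh≡0 = trans (dot-step (B r) x (- t) h) (trans (cong (λ z → dot (B r) x + - t * z) Brh≡0)
            (trans (cong (dot (B r) x +_) (ℚP.*-zeroʳ (- t))) (ℚP.+-identityʳ (dot (B r) x))))

          -- Reducing `x` by such a `y` leaves row `i` negative and would give a direction of
          -- smaller support in the cone.
          no-transversal : ∀ {y} → InKer y → (∀ r → Supp y r → Supp x r) → dot (B i) y ≡ 0ℚ → ∀ r → ¬ Supp y r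
          no-transversal {y} yK y⊆x Biy≡0 r yr = by (orient {x} {y} r yK yr (y⊆x r yr))
            where
            by : Oriented x y r → ⊥
            by (h , hK , aligned , zeros) = no-reduction hK red
                (subst (_< 0ℚ) (sym (dot-reduced i h (proj₁ red) (zeros i Biy≡0))) Bix<0)
              where
              red : Reduced x h
              red = reduce (λ r′ h′r → y⊆x r′ (h′r ∘ zeros r′)) r aligned

          -- The competitor `y` ranges over ker A, not only over the cone. If row `i` vanishes on
          -- `y`, `no-transversal` applies to `y`. Otherwise reducing `x` by `y` must make row `i`
          -- vanish, and `no-transversal` applies to the result: it is nonzero in row `r`, since `y`
          -- is zero there.
          MinimalTowards⇒SupportMinimal : ∀ {p₀} → InP p₀ → SupportMinimal x
          MinimalTowards⇒SupportMinimal {p₀} p₀P = xK , [ (λ x≈0 → contradiction (dot-zeroV (B i) x≈0) (<⇒≢ Bix<0))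
            , (λ x≢0 → x≢0) ]′ (≈0-or-NonZeroV x) , minimal-among
            where
            minimal-among : ∀ y → InKer y → NonZeroV y → (∀ r → Supp y r → Supp x r) → ∀ r → Supp x r → Supp y r
            minimal-among y yK y≢0 y⊆x r xr yr≡0 = by (dot (B i) y ≟ 0ℚ)
              where
              crossing : Oriented x y i → ⊥
              crossing (h , hK , aligned , zeros) = no-transversal (InKer-step (- t) xK hK)
                  (proj₁ (proj₂ (proj₂ (proj₂ red)))) Bix′≡0 r
                  (λ e → xr (trans (sym (dot-reduced r h t (zeros r yr≡0))) e))
                where
                red : Reduced x h
                red = reduce (λ r′ h′r → y⊆x r′ (h′r ∘ zeros r′)) i aligned
                t : ℚ
                t = proj₁ red
                Bix′≡0 : dot (B i) (reduced h t) ≡ 0ℚ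
                Bix′≡0 = ≤-antisym (proj₁ (proj₂ (proj₂ red)) i (<⇒≤ Bix<0)) (≮⇒≥ (no-reduction hK red))
              by : Dec (dot (B i) y ≡ 0ℚ) → ⊥
              by (yes Biy≡0) = no-transversal yK y⊆x Biy≡0
                (proj₁ (support-nonempty bounded p₀P yK y≢0)) (proj₂ (support-nonempty bounded p₀P yK y≢0))
              by (no Biy≢0) = crossing (orient {x} {y} i yK Biy≢0 (<⇒≢ Bix<0))

      -- Comparing the cones at two vertices

      edge-towards : ∀ {u v i j e} → Basic u → Basic v → Active u i → ¬ Active v i → Active v j →
        EdgeAt u i e → 0ℚ ≤ dot (B j) e
      edge-towards {u} {v} {i} {j} {e} u-basic v-basic ui ¬vi vj edge =
        ≤-stable (minimal-support (Towards {u} i j) v-u >>= from-minimal)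
        where
        uP : InP u
        uP = proj₁ u-basic
        vP : InP v
        vP = proj₁ v-basic
        v-u : Towards {u} i j (v ⊖ u)
        v-u = InKer-⊖ vP uP ,
          <-by _ (p<q⇒0<q-p (≤∧≢⇒< (proj₂ vP i) ¬vi)) (trans (cong (λ z → 0ℚ - z) (dot-⊖ (B i) v u))
            (trans (cong (λ z → 0ℚ - (dot (B i) v - z)) ui) (eqn (dot (B i) v) (d i)))) ,
          (λ r ur → ≤-by _ (slack≥0 vP r) (trans (cong (λ z → 0ℚ - z) (dot-⊖ (B r) v u))
            (trans (cong (λ z → 0ℚ - (dot (B r) v - z)) ur) (eqn (dot (B r) v) (d r))))) ,
          subst (0ℚ ≤_) (trans (cong (λ z → z - dot (B j) u) (sym vj)) (sym (dot-⊖ (B j) v u))) (slack≥0 uP j)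
          where
          eqn : ∀ v d → 0ℚ - (v - d) ≡ d - v
          eqn = solve-∀ ℚ-ring
        from-circuit : ∀ {x} → MinimalTowards {u} i j x → (g : Fin n → ℤ) → IsCircuit g →
          ∀ t → 0ℚ < t → toℚ g ≈ t · x → ¬ ¬ (0ℚ ≤ dot (B j) e)
        from-circuit {x} ((xK , Bix<0 , x-active , Bjx≥0) , _) g circ t t>0 g≈ =
          feasible-circuit-SpansEdge {u} {g} u-basic circ gF >>= λ spans →
          return (compare (spans (proj₁ edge) e-tight))
          where
          dot-g : ∀ r → dot (B r) (toℚ g) ≡ t * dot (B r) x
          dot-g r = trans (dot-cong (B r) g≈) (dot-· (B r) t x)
          scale≤0 : ∀ a → a ≤ 0ℚ → t * a ≤ 0ℚ
          scale≤0 a a≤0 = ≤-by _ (*-nonneg (<⇒≤ t>0) (p≤0⇒0≤-p a≤0)) (eqn t a)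
            where
            eqn : ∀ t a → 0ℚ - t * a ≡ t * - a
            eqn = solve-∀ ℚ-ring
          gF : Feasible u (toℚ g)
          gF = proj₁ circ , λ r ur → subst (_≤ 0ℚ) (sym (dot-g r)) (scale≤0 _ (x-active r ur))
          Big<0 : 0ℚ < - dot (B i) (toℚ g)
          Big<0 = subst (0ℚ <_) (trans (eqn t (dot (B i) x)) (cong -_ (sym (dot-g i)))) (*-pos t>0 (p<0⇒0<-p Bix<0))
            where
            eqn : ∀ t a → t * - a ≡ - (t * a)
            eqn = solve-∀ ℚ-ring
          -- An active row that changes along `e` determines row `i`, so it cannot vanish on `g`,
          -- where row `i` is negative.
          e-tight : ∀ r → Active u r → dot (B r) (toℚ g) ≡ 0ℚ → dot (B r) e ≡ 0ℚ
          e-tight r ur Brg≡0 = ≡-stable λ Bre≢0 → pos≢0 Big<0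
            (cong -_ (Determines-leaving edge r ur Bre≢0 (proj₁ circ) Brg≡0))
          compare : (Σ ℚ λ s → e ≈ s · toℚ g) → 0ℚ ≤ dot (B j) e
          compare (s , e≈) = subst (0ℚ ≤_) (sym (trans (dot-cong (B j) e≈) (dot-· (B j) s (toℚ g))))
            (*-nonneg s≥0 (subst (0ℚ ≤_) (sym (dot-g j)) (*-nonneg (<⇒≤ t>0) Bjx≥0)))
            where
            eqn : ∀ g s → - (s * g) ≡ - g * s
            eqn = solve-∀ ℚ-ring
            s≥0 : 0ℚ ≤ s
            s≥0 = *-cancel-nonneg Big<0 (subst (0ℚ ≤_) (trans (cong -_ (trans (sym (proj₁ (proj₂ edge)))
              (trans (dot-cong (B i) e≈) (dot-· (B i) s (toℚ g))))) (eqn (dot (B i) (toℚ g)) s)) (<⇒≤ 0<1))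
        from-minimal : Σ (Vecℚ n) (MinimalTowards {u} i j) → ¬ ¬ (0ℚ ≤ dot (B j) e)
        from-minimal (x , xM) = circuit-multiple (MinimalTowards⇒SupportMinimal {u} i j xM uP) >>=
          λ (g , circ , t , t>0 , g≈) → from-circuit xM g circ t t>0 g≈

      opposite-cone : ∀ {u v F g} → IsVertex u → IsVertex v → IsMinFace F u v → InnerCone F u g → InnerCone F v (neg g)
      opposite-cone {u} {v} {F} {g} u-vertex v-vertex (F-face , Fu , Fv , F-min) g∈ =
        InnerCone-resp {TightFace (Common v u)} {F} {v} (λ x (xP , tight) → TightFace-⊆ F-face Fu Fv x
          (xP , λ j (uj , vj) → tight j (vj , uj))) (neg g)
          (Common-InnerCone vP (InKer-neg gK , λ j vj → subst (_≤ 0ℚ) (sym (dot-neg (B j) g)) (0≤p⇒-p≤0 (towards j vj)))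
            λ j (vj , uj) → trans (dot-neg (B j) g) (cong -_ (g-common j (uj , vj))))
        where
        u-basic : Basic u
        u-basic = IsVertex⇒Basic u-vertex
        v-basic : Basic v
        v-basic = IsVertex⇒Basic v-vertex
        uP : InP u
        uP = proj₁ u-basic
        vP : InP v
        vP = proj₁ v-basic
        C : Pred n
        C = TightFace (Common u v)
        ε : ℚ
        ε = proj₁ g∈
        ε>0 : 0ℚ < ε
        ε>0 = proj₁ (proj₂ g∈)
        stepC : C (u ⊕ ε · g)
        stepC = F-min C (TightFace-isFace (common? u v)) (uP , λ j → proj₁) (vP , λ j → proj₂)
          (u ⊕ ε · g) (proj₂ (proj₂ g∈))
        gK : InKer g
        gK = InP⇒InKer ε>0 uP (proj₁ stepC)
        gF : Feasible u g
        gF = gK , feasible-active {u} {g} {ε} ε>0 (proj₁ stepC)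
        g-common : ∀ j → Common u v j → dot (B j) g ≡ 0ℚ
        g-common j uvj = *-cancel-0 (pos≢0 ε>0) (trans (eqn (d j) (ε * dot (B j) g))
          (trans (cong (_- d j) (trans (cong (_+ ε * dot (B j) g) (sym (proj₁ uvj)))
            (trans (sym (dot-step (B j) u ε g)) (proj₂ stepC j uvj)))) (ℚP.+-inverseʳ (d j))))
          where
          eqn : ∀ b x → x ≡ b + x - b
          eqn = solve-∀ ℚ-ring
        towards : ∀ j → Active v j → 0ℚ ≤ dot (B j) g
        -- An edge direction entering `g` leaves a row `i` that is not active at `v`, because all
        -- common rows vanish on `g`.
        towards j vj = cone-nonneg minimal simple u-basic j gF λ i ui Big<0 e edge eF →
          edge-towards u-basic v-basic ui (λ vi → <⇒≢ Big<0 (g-common i (ui , vi))) vj edge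

      opposite-cones : InnerConeCondition
      opposite-cones u v u-vertex v-vertex F F-min@(F-face , Fu , Fv , F-least) g = mk⇔
        (opposite-cone u-vertex v-vertex F-min)
        (λ g∈ → double-neg (opposite-cone v-vertex u-vertex (F-face , Fv , Fu , λ G G-face Gv Gu → F-least G G-face Gu Gv) g∈))
        where
        neg-neg : ∀ a b t → a + t * - (- b) ≡ a + t * b
        neg-neg = solve-∀ ℚ-ring
        double-neg : InnerCone F u (neg (neg g)) → InnerCone F u g
        double-neg (ε , ε>0 , Fx) = ε , ε>0 , IsFace-≈ F-face (λ c → neg-neg (u c) (g c) ε) Fx


theorem6 : ∀ {n p m : ℕ}
    (A : Fin p → Vecℚ n) (b : Fin p → ℚ) (B : Fin m → Vecℚ n) (d : Fin m → ℚ) →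
    Poly.Bounded A b B d → Poly.MinimalRep A b B d → Poly.Simple A b B d →
    Poly.AllCircuitWalksAreEdgeWalks A b B d ⇔ Poly.InnerConeCondition A b B d
theorem6 A b B d bounded minimal simple = mk⇔
  (Geometry.FromWalks.opposite-cones A b B d bounded minimal simple)
  (λ cones v₁ v₂ v₁-vertex _ k y walk → Geometry.FromCones.walk-is-edge-walk A b B d bounded minimal simple cones
    k y (Geometry.IsVertex⇒Basic A b B d v₁-vertex) walk)
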